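{- Let $T$ be an $E$-combination of some theories $T_i$, $i\in I$, and let $\mathcal{T}$ be an $E$-closed set of theories. If $|e_\mathcal{T}\mbox{ - }{\rm Sp}(T)|<2^\omega$, then ${\rm Cl}_E(\mathcal{T}\cup\{T_i\mid i\in I\})$ has the $\mathcal{T}$-least generating set.
   Context: Languages are relational; "theory" means a complete first-order theory. All theories considered (apart from $E$-combinations) are regarded in a common language $\Sigma$ not containing the binary symbol $E$; a theory in a smaller language is regarded as a $\Sigma$-theory by declaring the missing predicates empty. $E$-combination: given $\Sigma$-structures $(\mathcal{A}_i)_{i\in I}$ (taken with pairwise disjoint universes), $\mathcal{A}_E={\rm Comb}_E(\mathcal{A}_i)_{i\in I}$ is their disjoint union (each predicate symbol is interpreted as the union of its interpretations in the $\mathcal{A}_i$) expanded by an equivalence relation $E$ whose classes are exactly the universes of the $\mathcal{A}_i$. Its theory depends only on the theories $T_i={\rm Th}(\mathcal{A}_i)$ and is called the $E$-combination of the $T_i$. For $\mathcal{A}'\equiv\mathcal{A}_E$, each $E$-class of $\mathcal{A}'$ is regarded as a $\Sigma$-structure (the restriction of $\mathcal{A}'$ to the class, forgetting $E$); its theory is called a theory of an $E$-class of $\mathcal{A}'$. Relative $e$-spectrum: let $T={\rm Th}(\mathcal{A}_E)$ and let $\mathcal{T}$ be a class of theories. For a model $\mathcal{M}$ of $T$, let $e_{\mathcal{T}}$-${\rm Sp}(\mathcal{M})$ be the number (cardinality) of theories that are theories of $E$-classes of models of $T$, are not theories of $E$-classes of $\mathcal{M}$, and do not belong to $\mathcal{T}$.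 Then $e_{\mathcal{T}}$-${\rm Sp}(T)$ is the supremum of $e_{\mathcal{T}}$-${\rm Sp}(\mathcal{M})$ over all models $\mathcal{M}$ of $T$. $E$-closure: for a set $\mathcal{S}$ of theories, ${\rm Cl}_E(\mathcal{S})$ is the set of all theories of $E$-classes of structures $\mathcal{A}'\equiv\mathcal{A}_E$, where $\mathcal{A}_E={\rm Comb}_E(\mathcal{A}_i)_{i\in I}$ with ${\rm Th}(\mathcal{A}_i)\in\mathcal{S}$ for all $i\in I$. $\mathcal{S}$ is $E$-closed if $\mathcal{S}={\rm Cl}_E(\mathcal{S})$. Relative notions: ${\rm Cl}_{E,\mathcal{T}}(\mathcal{S})={\rm Cl}_E(\mathcal{S})\setminus\mathcal{T}$. A subset $\mathcal{T}'_0\subseteq\mathcal{T}_0$ of an $E$-closed set $\mathcal{T}_0$ is $\mathcal{T}$-relatively generating for $\mathcal{T}_0$ if $\mathcal{T}_0\setminus\mathcal{T}={\rm Cl}_{E,\mathcal{T}}(\mathcal{T}'_0)$. A $\mathcal{T}$-relatively generating set $\mathcal{T}'_0$ is $\mathcal{T}$-minimal if $\mathcal{T}'_0\setminus\mathcal{T}$ has no proper subset $\mathcal{T}''_0$ with $\mathcal{T}_0\setminus\mathcal{T}={\rm Cl}_{E,\mathcal{T}}((\mathcal{T}'_0\cap\mathcal{T})\cup\mathcal{T}''_0)$. A $\mathcal{T}$-minimal $\mathcal{T}$-relatively generating set $\mathcal{T}'_0$ is $\mathcal{T}$-least if $\mathcal{T}'_0\setminus\mathcal{T}\subseteq\mathcal{T}''_0\setminus\mathcal{T}$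 for each $\mathcal{T}$-relatively generating set $\mathcal{T}''_0$ for $\mathcal{T}_0$. -}

module Defs where

open import Data.Bool.Base using (Bool)
open import Data.Fin.Base using (Fin)
open import Data.Nat.Base using (ℕ; zero; suc)
open import Data.Product.Base using (Σ; Σ-syntax; ∃-syntax; _×_; _,_; proj₁; proj₂)
open import Data.Refinement using (Refinement-syntax; value)
open import Data.Empty using (⊥)
open import Data.Irrelevant using ([_])
open import Data.Sum.Base using (_⊎_)
open import Data.Vec.Base using (Vec; []; _∷_; lookup; map)
open import Function.Base using (id; _on_)
open import Function.Bundles using (Injection)
open import Level using (Level; 0ℓ) renaming (suc to lsuc)
open import Relation.Binary.Bundles using (Setoid)
open import Relation.Binary.Definitions using (_Respects_)
open import Relation.Binary.PropositionalEquality using (_≡_; _→-setoid_)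
open import Relation.Nullary.Negation using (¬_)
open import Relation.Unary using (Pred; _∈_; _∉_; _⊆_; _⊂_; _≐_; _∩_; _∪_; _∖_)

1ℓ : Level
1ℓ = lsuc 0ℓ

------------------------------------------------------------------------
-- First-order logic with equality over relational languages

-- A symbol in Rel k has arity suc k.  Nullary symbols are excluded: for
-- them a disjoint union would not restrict to the given structures on
-- its components.
record Language : Set₁ where
  field
    Rel : ℕ → Set

open Language public

-- Formulas with free variables in Fin n; a quantifier binds variable zero.
-- The semantics is used classically, where these connectives suffice.
data Formula (L : Language) (n : ℕ) : Set where
  falsum : Formula L n
  _==_   : Fin n → Fin n → Formula L n
  atom   : ∀ {k} → Rel L k → Vec (Fin n) (suc k) → Formula L n
  _⇒_    : Formula L n → Formula L n → Formula L n
  all    : Formula L (suc n) → Formula L n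

neg : ∀ {L n} → Formula L n → Formula L n
neg φ = φ ⇒ falsum

Sentence : Language → Set
Sentence L = Formula L zero

record Structure (L : Language) : Set₁ where
  field
    Carrier : Set
    point   : Carrier
    interp  : ∀ {k} → Rel L k → Vec Carrier (suc k) → Set

open Structure public

Sat : ∀ {L n} (A : Structure L) → Vec (Carrier A) n → Formula L n → Set
Sat A ρ falsum      = ⊥
Sat A ρ (x == y)    = lookup ρ x ≡ lookup ρ y
Sat A ρ (atom R xs) = interp A R (map (lookup ρ) xs)
Sat A ρ (φ ⇒ ψ)     = Sat A ρ φ → Sat A ρ ψ
Sat A ρ (all φ)     = ∀ a → Sat A (a ∷ ρ) φ

Th : ∀ {L} → Structure L → Pred (Sentence L) 0ℓ
Th A φ = Sat A [] φ

_≡ₑ_ : ∀ {L} → Structure L → Structure L → Set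
A ≡ₑ B = Th A ≐ Th B

-- Complete theories.  Deductive closure follows (classically) from
-- satisfiability and completeness.
record Theory (L : Language) : Set₁ where
  field
    sentences   : Pred (Sentence L) 0ℓ
    satisfiable : Σ[ A ∈ Structure L ] sentences ⊆ Th A
    complete    : ∀ φ → φ ∈ sentences ⊎ neg φ ∈ sentences

open Theory public

-- Theories are compared by their sentences only.
_≈_ : ∀ {L} → Theory L → Theory L → Set
_≈_ = _≐_ on sentences

_⊨_ : ∀ {L} → Structure L → Theory L → Set
M ⊨ T = sentences T ⊆ Th M

_HasTheory_ : ∀ {L} → Structure L → Theory L → Set
A HasTheory T = sentences T ≐ Th A

-- Classes of theories.  Those meant as sets must additionally respect _≈_.
Theories : Language → Set₂
Theories L = Pred (Theory L) 1ℓ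

------------------------------------------------------------------------
-- E-combinations

data RelE (L : Language) : ℕ → Set where
  base : ∀ {k} → Rel L k → RelE L k
  E    : RelE L 1

_+E : Language → Language
Rel (L +E) = RelE L

module _ {L : Language} where

  -- Universes are nonempty, so the index set must be nonempty too.
  Comb : {I : Set} → I → (I → Structure L) → Structure (L +E)
  Carrier (Comb {I} i₀ A) = Σ[ i ∈ I ] Carrier (A i)
  point   (Comb i₀ A) = i₀ , point (A i₀)
  interp  (Comb i₀ A) (base R) v =
    ∃[ i ] ∃[ w ] (v ≡ map (i ,_) w × interp (A i) R w)
  interp  (Comb i₀ A) E (x ∷ y ∷ []) = proj₁ x ≡ proj₁ y

  -- The E-class of a.  The membership proof is irrelevant, so that the
  -- carrier is a genuine subset.
  EClass : (M : Structure (L +E)) (a : Carrier M) →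
           interp M E (a ∷ a ∷ []) → Structure L
  Carrier (EClass M a r) = [ b ∈ Carrier M ∣ interp M E (a ∷ b ∷ []) ]
  point   (EClass M a r) = a Data.Refinement., [ r ]
  interp  (EClass M a r) R v = interp M (base R) (map value v)

  -- In models of an E-combination E is reflexive, so r always exists there.
  IsClassTheory : Structure (L +E) → Theory L → Set
  IsClassTheory M S = ∃[ a ] ∃[ r ] EClass M a r HasTheory S

  IsECombination : {I : Set} → I → Theory (L +E) → (I → Theory L) → Set₁
  IsECombination {I} i₀ T Ts =
    Σ[ A ∈ (I → Structure L) ]
      (∀ i → A i HasTheory Ts i) × Comb i₀ A HasTheory T

  Cl-E : Theories L → Theories L
  Cl-E S T′ =
    Σ[ I ∈ Set ] Σ[ i₀ ∈ I ] Σ[ A ∈ (I → Structure L) ]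
      (∀ i → Σ[ T ∈ Theory L ] (T ∈ S × A i HasTheory T)) ×
      Σ[ M ∈ Structure (L +E) ] (M ≡ₑ Comb i₀ A × IsClassTheory M T′)

  EClosed : Theories L → Set₁
  EClosed S = S ≐ Cl-E S

  Range : {I : Set} → (I → Theory L) → Pred (Theory L) 0ℓ
  Range Ts T = ∃[ i ] T ≈ Ts i

------------------------------------------------------------------------
-- Cardinalities and the relative e-spectrum

-- A cardinal is given by a setoid having that many elements.
Cardinal : Set₂
Cardinal = Setoid 1ℓ 0ℓ

_≲_ : ∀ {a b c d} → Setoid a b → Setoid c d → Set _
_≲_ = Injection

_⋦_ : ∀ {a b c d} → Setoid a b → Setoid c d → Set _
κ ⋦ μ = κ ≲ μ × ¬ (μ ≲ κ)

2^ω : Setoid 0ℓ 0ℓ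
2^ω = ℕ →-setoid Bool

module _ {L : Language} where

  ∥_∥ : Theories L → Cardinal
  ∥ S ∥ = record
    { Carrier       = Σ (Theory L) S
    ; _≈_           = λ S T → proj₁ S ≈ proj₁ T
    ; isEquivalence = record
      { refl  = id , id
      ; sym   = λ (p , q) → q , p
      ; trans = λ (p , q) (p′ , q′) → (λ x → p′ (p x)) , (λ x → q (q′ x))
      }
    }

  ESpTheories : Theories L → Theory (L +E) → Structure (L +E) → Theories L
  ESpTheories 𝒯 T M S =
    (Σ[ N ∈ Structure (L +E) ] (N ⊨ T × IsClassTheory N S)) ×
    ¬ IsClassTheory M S ×
    S ∉ 𝒯

  -- κ is the supremum of e_𝒯-Sp(M) over all models M of T.
  record IsESp (𝒯 : Theories L) (T : Theory (L +E)) (κ : Cardinal) : Set₂ where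
    field
      upper : ∀ M → M ⊨ T → ∥ ESpTheories 𝒯 T M ∥ ≲ κ
      least : ∀ (μ : Cardinal) →
              (∀ M → M ⊨ T → ∥ ESpTheories 𝒯 T M ∥ ≲ μ) → κ ≲ μ

------------------------------------------------------------------------
-- Relatively generating sets

  Cl-E[_] : Theories L → Theories L → Theories L
  Cl-E[ 𝒯 ] S = Cl-E S ∖ 𝒯

  record IsGenerating (𝒯 𝒯₀ 𝒯₀′ : Theories L) : Set₁ where
    field
      closed    : EClosed 𝒯₀
      respects  : 𝒯₀′ Respects _≈_
      subset    : 𝒯₀′ ⊆ 𝒯₀
      generates : 𝒯₀ ∖ 𝒯 ≐ Cl-E[ 𝒯 ] 𝒯₀′

  record IsMinimalGenerating (𝒯 𝒯₀ 𝒯₀′ : Theories L) : Set₂ where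
    field
      generating : IsGenerating 𝒯 𝒯₀ 𝒯₀′
      minimal    : ¬ (Σ[ 𝒯₀″ ∈ Theories L ]
                        𝒯₀″ Respects _≈_ ×
                        𝒯₀″ ⊂ 𝒯₀′ ∖ 𝒯 ×
                        𝒯₀ ∖ 𝒯 ≐ Cl-E[ 𝒯 ] ((𝒯₀′ ∩ 𝒯) ∪ 𝒯₀″))

  record IsLeastGenerating (𝒯 𝒯₀ 𝒯₀′ : Theories L) : Set₂ where
    field
      minimalGenerating : IsMinimalGenerating 𝒯 𝒯₀ 𝒯₀′
      least             : ∀ 𝒯₀″ → IsGenerating 𝒯 𝒯₀ 𝒯₀″ → 𝒯₀′ ∖ 𝒯 ⊆ 𝒯₀″ ∖ 𝒯

{-# OPTIONS --safe #-}
module Submission where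

-- For relational languages Cl-E is the topological closure in the space of
-- complete theories.  By a back-and-forth argument, the theory of an
-- E-combination does not change when the components satisfying φ₀ are replaced
-- by others, provided that every sentence true in one of the old or new
-- components holds in infinitely many of both.
--
-- Let X be the E-closure in question.  If the isolated points of X are dense in
-- X ∖ 𝒯, they form the 𝒯-least generating set.  Otherwise some φ₀ that belongs
-- to no theory in 𝒯 cuts out a nonempty perfect part of X.  A Cantor scheme and
-- ultraproducts give 2^ω distinct theories there whose complement is still
-- dense, so that T has a model omitting all of them, against the bound on the
-- relative e-spectrum.

open import Defs
open import Axiom.ExcludedMiddle using (ExcludedMiddle)
open import Axiom.Extensionality.Propositional using (Extensionality)
open import Data.Bool.Base using (Bool; true; false; not)
open import Data.Bool.Properties using (⇔→≡; ¬-not; not-¬)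
open import Data.Empty using (⊥; ⊥-elim-irr)
open import Data.Fin.Base using (Fin; zero; suc; toℕ; _↑ˡ_; _↑ʳ_)
open import Data.Fin.Properties using (pigeonhole)
open import Data.Irrelevant using ([_])
open import Data.List.Base as List using (List; []; _∷_)
open import Data.List.Membership.Propositional using () renaming (_∈_ to _∈ˡ_)
open import Data.List.Membership.Propositional.Properties
  using (∈-map⁺; ∈-++⁺ˡ; ∈-++⁺ʳ; ∈-++⁻)
open import Data.List.Properties using () renaming (∷-injectiveˡ to ∷ˡ-injectiveˡ)
open import Data.List.Relation.Unary.Any using (here; there)
open import Data.Nat.Base using (ℕ; zero; suc; _+_; _≤_; _⊔_; _≤′_; ≤′-refl; ≤′-step)
open import Data.Nat.Binary.Base using (ℕᵇ; 2[1+_]; 1+[2_]) renaming (toℕ to toℕᵇ)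
open import Data.Nat.Binary.Properties
  using (toℕ-injective; 2[1+_]-injective; 1+[2_]-injective)
open import Data.Nat.Properties
  using (n<1+n; <⇒≢; ≤-refl; ≤-trans; m≤m⊔n; m≤n⊔m; ≤⇒≤′)
open import Data.Product.Base using (Σ; Σ-syntax; ∃; ∃-syntax; _×_; _,_; proj₁; proj₂; swap)
open import Data.Refinement using (_,_; Refinement-syntax; value; value-injective)
open import Data.Sum.Base using (_⊎_; inj₁; inj₂; [_,_]′)
open import Data.Unit.Base using (⊤; tt)
open import Data.Vec.Base using (Vec; []; _∷_; lookup; map; _++_)
open import Data.Vec.Properties
  using (∷-injectiveˡ; ∷-injectiveʳ; lookup-map; map-∘; map-cong; lookup-++ˡ; lookup-++ʳ)
open import Function.Base using (id; _∘_; flip)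
open import Function.Bundles using (mk⇔)
open import Function.Construct.Composition using (injection)
open import Relation.Binary.Definitions using (_Respects_)
open import Relation.Binary.PropositionalEquality
  using (_≡_; _≢_; _≗_; refl; sym; trans; cong; cong₂; subst; subst₂)
open import Relation.Binary.PropositionalEquality.WithK using (≡-irrelevant)
open import Relation.Nullary.Decidable.Core
  using (Dec; yes; no; does; toSum; decidable-stable; recompute)
open import Relation.Nullary.Negation using (¬_; contradiction)
open import Relation.Unary using (_∈_; _∉_; _⊆_; _∩_; _∪_; _∖_)

-- The spectrum counts theories missing from one single model, so continuum many theories have to be
-- omitted together while those that remain stay dense. A choice of one theory per branch of a
-- Cantor scheme need not do this: if every branch carries a single theory, the choice exhausts the
-- perfect part. But then the nodes of the scheme form a countable base, which yields countably many
-- dense centres, and a diagonal argument keeps continuum many branches away from them. The language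
-- may have any size, so a countable base cannot be assumed from the outset and both cases are
-- needed. Choice comes from `em`: deciding a Σ-type hands over a witness.

conj : ∀ {L n} → Formula L n → Formula L n → Formula L n
conj φ ψ = neg (φ ⇒ neg ψ)

ex : ∀ {L n} → Formula L (suc n) → Formula L n
ex φ = neg (all (neg φ))

truth : ∀ {L n} → Formula L n
truth = neg falsum

_⟺_ : Set → Set → Set
P ⟺ Q = (P → Q) × (Q → P)

-- Agreement on finitely many formulas

Agree : ∀ {L n} → List (Formula L n) →
        (A : Structure L) → Vec (Carrier A) n →
        (B : Structure L) → Vec (Carrier B) n → Set
Agree Δ A ρ B σ = ∀ {δ} → δ ∈ˡ Δ → Sat A ρ δ ⟺ Sat B σ δ

agree-sym : ∀ {L n} {Δ : List (Formula L n)} {A ρ B σ} →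
            Agree Δ A ρ B σ → Agree Δ B σ A ρ
agree-sym ag δ∈ = swap (ag δ∈)

completions : ∀ {L n} → List (Formula L n) → List (Formula L n)
completions []      = truth ∷ []
completions (δ ∷ Δ) = List.map (conj δ) (completions Δ) List.++
                           List.map (conj (neg δ)) (completions Δ)

-- Agreement on quantify Δ allows one more move of the
-- Ehrenfeucht–Fraïssé game after which there is agreement on Δ.
quantify : ∀ {L n} → List (Formula L (suc n)) → List (Formula L n)
quantify Δ = List.map ex (completions Δ)

close : ∀ {L} n → List (Formula L n) → List (Sentence L)
close zero    Δ = Δ
close (suc n) Δ = close n (quantify Δ)

-- The formulas that a formula over a disjoint union asks about a single
-- component.
locals : ∀ {L n} → Formula (L +E) n → List (Formula L n)
locals falsum             = []
locals (x == y)           = (x == y) ∷ []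
locals (atom (base R) xs) = atom R xs ∷ []
locals (atom E xs)        = []
locals (φ ⇒ ψ)            = locals φ List.++ locals ψ
locals (all φ)            = quantify (locals φ)

module _ (em : ∀ ℓ → ExcludedMiddle ℓ) where

  stable : ∀ {p} {P : Set p} → ¬ ¬ P → P
  stable = decidable-stable (em _)

  conj⁻ : ∀ {L n} (A : Structure L) ρ (φ ψ : Formula L n) →
          Sat A ρ (conj φ ψ) → Sat A ρ φ × Sat A ρ ψ
  conj⁻ A ρ φ ψ h =
    stable (λ ¬p → h (λ p _ → ¬p p)) , stable (λ ¬q → h (λ _ q → ¬q q))

  conj⁺ : ∀ {L n} (A : Structure L) ρ (φ ψ : Formula L n) →
          Sat A ρ φ → Sat A ρ ψ → Sat A ρ (conj φ ψ)
  conj⁺ A ρ φ ψ p q f = f p q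

  ex⁻ : ∀ {L n} (A : Structure L) ρ (φ : Formula L (suc n)) →
        Sat A ρ (ex φ) → ∃[ a ] Sat A (a ∷ ρ) φ
  ex⁻ A ρ φ h = stable (λ ¬∃ → h (λ a s → ¬∃ (a , s)))

  -- The finite type over `Δ` is compressed into one formula, so that hypotheses about a single
  -- sentence, such as density, later control all of `Δ`.
  completion : ∀ {L n} (Δ : List (Formula L n)) (A : Structure L) ρ →
               ∃[ τ ] τ ∈ˡ completions Δ × Sat A ρ τ ×
                 (∀ B σ → Sat B σ τ → Agree Δ A ρ B σ)
  completion [] A ρ = truth , here refl , id , λ _ _ _ ()
  completion (δ ∷ Δ) A ρ with completion Δ A ρ | em _ {P = Sat A ρ δ}
  ... | τ , τ∈ , s , c | yes p =
    conj δ τ , ∈-++⁺ˡ (∈-map⁺ (conj δ) τ∈) , conj⁺ A ρ δ τ p s , λ where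
      B σ h (here refl) → (λ _ → proj₁ (conj⁻ B σ δ τ h)) , λ _ → p
      B σ h (there ε∈)  → c B σ (proj₂ (conj⁻ B σ δ τ h)) ε∈
  ... | τ , τ∈ , s , c | no ¬p =
    conj (neg δ) τ ,
    ∈-++⁺ʳ (List.map (conj δ) (completions Δ)) (∈-map⁺ (conj (neg δ)) τ∈) ,
    conj⁺ A ρ (neg δ) τ ¬p s , λ where
      B σ h (here refl) →
        (λ p → contradiction p ¬p) ,
        λ q → contradiction q (proj₁ (conj⁻ B σ (neg δ) τ h))
      B σ h (there ε∈)  → c B σ (proj₂ (conj⁻ B σ (neg δ) τ h)) ε∈

  move : ∀ {L n} (Δ : List (Formula L (suc n))) {A : Structure L} {ρ B σ} →
         Agree (quantify Δ) A ρ B σ → ∀ a → ∃[ b ] Agree Δ A (a ∷ ρ) B (b ∷ σ)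
  move Δ {A} {ρ} {B} {σ} ag a =
    let τ , τ∈ , s , c = completion Δ A (a ∷ ρ)
        b , t = ex⁻ B σ τ (proj₁ (ag (∈-map⁺ ex τ∈)) (λ f → f a s))
    in b , c B (b ∷ σ) t

  -- A component entered for the first time agrees with its partner on sentences only, but a block
  -- needs contexts of full length. The entries are dummy moves, each paid for by one `quantify`.
  fill : ∀ {L} n (Δ : List (Formula L n)) {A B : Structure L} →
         Agree (close n Δ) A [] B [] → ∃[ ρ ] ∃[ σ ] Agree Δ A ρ B σ
  fill zero    Δ ag = [] , [] , ag
  fill (suc n) Δ {A} ag =
    let ρ , σ , ag′ = fill n (quantify Δ) ag
        b , ag″ = move Δ ag′ (point A)
    in point A ∷ ρ , b ∷ σ , ag″

  module _ {L : Language} where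

    -- Ehrenfeucht–Fraïssé games on disjoint unions

    -- C constrains which components may be matched with each other.
    Forth : {I J : Set} → (I → Structure L) → (J → Structure L) →
            (I → J → Set) → Set
    Forth {I} {J} A B C =
      ∀ {n} (is : Fin n → I) (js : Fin n → J) → (∀ k → C (is k) (js k)) →
      ∀ Δ i → (∀ k → is k ≢ i) →
      ∃[ j ] (∀ k → js k ≢ j) × C i j × Agree Δ (A i) [] (B j) []

    -- A component carries local contexts of full length; the entries for
    -- variables that live elsewhere are arbitrary.
    Block : ∀ {I J : Set} (A : I → Structure L) (B : J → Structure L) {n} →
            List (Formula L n) →
            Vec (Σ I (Carrier ∘ A)) n → Vec (Σ J (Carrier ∘ B)) n → I → J → Set
    Block A B Δ ρ σ i j =
      ∃[ α ] ∃[ β ] Agree Δ (A i) α (B j) β ×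
        (∀ l → proj₁ (lookup ρ l) ≡ i →
           lookup ρ l ≡ (i , lookup α l) × lookup σ l ≡ (j , lookup β l))

    -- A position of the game: a bijection between the components visited so far, and one local game
    -- in each matched pair. `Δ` measures what all local games can still afford.
    record Matched {I J : Set} (A : I → Structure L) (B : J → Structure L)
                   (C : I → J → Set) {n} (Δ : List (Formula L n))
                   (ρ : Vec (Σ I (Carrier ∘ A)) n)
                   (σ : Vec (Σ J (Carrier ∘ B)) n) : Set where
      field
        same   : ∀ k l → proj₁ (lookup ρ k) ≡ proj₁ (lookup ρ l) →
                         proj₁ (lookup σ k) ≡ proj₁ (lookup σ l)
        same⁻  : ∀ k l → proj₁ (lookup σ k) ≡ proj₁ (lookup σ l) →
                         proj₁ (lookup ρ k) ≡ proj₁ (lookup ρ l)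
        colour : ∀ k → C (proj₁ (lookup ρ k)) (proj₁ (lookup σ k))
        block  : ∀ k → Block A B Δ ρ σ (proj₁ (lookup ρ k)) (proj₁ (lookup σ k))

    open Matched

    module _ {I J : Set} {A : I → Structure L} {B : J → Structure L}
             {C : I → J → Set} where

      matched-sym : ∀ {n} {Δ : List (Formula L n)} {ρ σ} →
                    Matched A B C Δ ρ σ → Matched B A (flip C) Δ σ ρ
      matched-sym m .same   = same⁻ m
      matched-sym m .same⁻  = same m
      matched-sym m .colour = colour m
      matched-sym {Δ = Δ} {ρ} {σ} m .block k =
        let α , β , ag , pts = block m k
        in β , α , agree-sym {Δ = Δ} ag , λ l e → swap (pts l (same⁻ m l k e))

      matched-⊆ : ∀ {n} {Δ Δ′ : List (Formula L n)} {ρ σ} →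
                  (∀ {δ} → δ ∈ˡ Δ′ → δ ∈ˡ Δ) →
                  Matched A B C Δ ρ σ → Matched A B C Δ′ ρ σ
      matched-⊆ sub m .same   = same m
      matched-⊆ sub m .same⁻  = same⁻ m
      matched-⊆ sub m .colour = colour m
      matched-⊆ sub m .block k =
        let α , β , ag , pts = block m k
        in α , β , (λ δ∈ → ag (sub δ∈)) , pts

      push : ∀ {n} (Δ : List (Formula L (suc n))) {ρ σ i j x y} →
             Matched A B C (quantify Δ) ρ σ →
             (∀ l → i ≡ proj₁ (lookup ρ l) → j ≡ proj₁ (lookup σ l)) →
             (∀ l → j ≡ proj₁ (lookup σ l) → i ≡ proj₁ (lookup ρ l)) →
             C i j → Block A B Δ ((i , x) ∷ ρ) ((j , y) ∷ σ) i j →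
             Matched A B C Δ ((i , x) ∷ ρ) ((j , y) ∷ σ)
      push Δ m to from c b .same zero    zero    _ = refl
      push Δ m to from c b .same zero    (suc l) e = to l e
      push Δ m to from c b .same (suc k) zero    e = sym (to k (sym e))
      push Δ m to from c b .same (suc k) (suc l) e = same m k l e
      push Δ m to from c b .same⁻ zero    zero    _ = refl
      push Δ m to from c b .same⁻ zero    (suc l) e = from l e
      push Δ m to from c b .same⁻ (suc k) zero    e = sym (from k (sym e))
      push Δ m to from c b .same⁻ (suc k) (suc l) e = same⁻ m k l e
      push Δ m to from c b .colour zero    = c
      push Δ m to from c b .colour (suc k) = colour m k
      push Δ m to from c b .block zero = b
      push Δ {ρ} {σ} {i} {x = x} {y} m to from c b .block (suc k)
        with em _ {P = i ≡ proj₁ (lookup ρ k)}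
      ... | yes e = subst₂ (Block A B Δ ((_ , x) ∷ ρ) ((_ , y) ∷ σ)) e (to k e) b
      ... | no ¬e =
        -- The new variable lives elsewhere, yet this block needs an entry for it: a dummy point
        -- answered by a local move. Hence each move costs every block one `quantify`.
        let α , β , ag , pts = block m k
            b′ , ag′ = move Δ ag (point (A (proj₁ (lookup ρ k))))
        in point (A (proj₁ (lookup ρ k))) ∷ α , b′ ∷ β , ag′ , λ where
             zero    e → contradiction e ¬e
             (suc l) e → pts l e

      extend : Forth A B C → ∀ {n} (Δ : List (Formula L (suc n))) {ρ σ} →
               Matched A B C (quantify Δ) ρ σ →
               ∀ a → ∃[ b ] Matched A B C Δ (a ∷ ρ) (b ∷ σ)
      extend fo {n} Δ {ρ} {σ} m (i , x) with em _ {P = ∃[ k ] proj₁ (lookup ρ k) ≡ i}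
      ... | yes (k , refl) =
        let α , β , ag , pts = block m k
            y , ag′ = move Δ ag x
        in (proj₁ (lookup σ k) , y) ,
           push Δ m (same m k) (same⁻ m k) (colour m k)
             (x ∷ α , y ∷ β , ag′ , λ where
               zero    _ → refl , refl
               (suc l) e → pts l e)
      ... | no new =
        -- `close (suc n) Δ` pays for `n` dummy entries and the genuine move `x`.
        let j , fresh , c , ag = fo (proj₁ ∘ lookup ρ) (proj₁ ∘ lookup σ) (colour m)
                                   (close (suc n) Δ) i (λ k e → new (k , e))
            α , β , ag′ = fill n (quantify Δ) ag
            y , ag″ = move Δ ag′ x
        in (j , y) ,
           push Δ m (λ l e → contradiction (l , sym e) new)
             (λ l e → contradiction (sym e) (fresh l)) c
             (x ∷ α , y ∷ β , ag″ , λ where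
               zero    _ → refl , refl
               (suc l) e → contradiction (l , e) new)

    ,-injʳ : ∀ {X : Set} {Y : X → Set} {x : X} {y y′ : Y x} →
             _≡_ {A = Σ X Y} (x , y) (x , y′) → y ≡ y′
    ,-injʳ refl = refl

    -- An atom of a disjoint union holds only of tuples inside one component, so a single block
    -- suffices to translate its arguments.
    confined : ∀ {I J : Set} (A : I → Structure L) (B : J → Structure L)
               {n} (ρ : Vec (Σ I (Carrier ∘ A)) n) (σ : Vec (Σ J (Carrier ∘ B)) n)
               {i j} (α : Vec (Carrier (A i)) n) (β : Vec (Carrier (B j)) n) →
               (∀ l → proj₁ (lookup ρ l) ≡ i →
                  lookup ρ l ≡ (i , lookup α l) × lookup σ l ≡ (j , lookup β l)) →
               ∀ {m} (xs : Vec (Fin n) m) w → map (lookup ρ) xs ≡ map (i ,_) w →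
               w ≡ map (lookup α) xs ×
               map (lookup σ) xs ≡ map (j ,_) (map (lookup β) xs)
    confined A B ρ σ α β pts []       []      _ = refl , refl
    confined A B ρ σ α β pts (x ∷ xs) (u ∷ w) e =
      let p , q = pts x (cong proj₁ (∷-injectiveˡ e))
          p′ , q′ = confined A B ρ σ α β pts xs w (∷-injectiveʳ e)
      in cong₂ _∷_ (,-injʳ (trans (sym (∷-injectiveˡ e)) p)) p′ , cong₂ _∷_ q q′

    -- Implication reverses the direction, and a challenge to a universal formula in one structure
    -- is answered in the other, so both strategies are carried along.
    transfer : ∀ {I J : Set} {A : I → Structure L} {B : J → Structure L}
               {C : I → J → Set} (i₀ : I) (j₀ : J) →
               Forth A B C → Forth B A (flip C) →
               ∀ {n} (φ : Formula (L +E) n) {ρ σ} → Matched A B C (locals φ) ρ σ →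
               Sat (Comb i₀ A) ρ φ → Sat (Comb j₀ B) σ φ
    transfer i₀ j₀ fo ba falsum m ()
    transfer i₀ j₀ fo ba (x == y) m e
      with block m y
    ... | α , β , ag , pts
      with pts x (cong proj₁ e) | pts y refl
    ... | p , p′ | q , q′ with trans (sym p) (trans e q)
    ... | r = trans p′ (trans (cong (_ ,_) (proj₁ (ag (here refl)) (,-injʳ r))) (sym q′))
    transfer {A = A} {B} i₀ j₀ fo ba (atom (base R) (x ∷ xs)) {ρ} {σ} m (i , u ∷ w , e , r)
      with cong proj₁ (∷-injectiveˡ e)
    ... | refl with block m x
    ... | α , β , ag , pts
      with confined A B ρ σ α β pts (x ∷ xs) (u ∷ w) e
    ... | p , q = _ , _ , q , proj₁ (ag (here refl)) (subst (interp (A _) R) p r)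
    transfer i₀ j₀ fo ba (atom E (x ∷ y ∷ [])) m e = same m x y e
    transfer i₀ j₀ fo ba (φ ⇒ ψ) m h p =
      transfer i₀ j₀ fo ba ψ (matched-⊆ (∈-++⁺ʳ (locals φ)) m)
        (h (transfer j₀ i₀ ba fo φ (matched-sym (matched-⊆ ∈-++⁺ˡ m)) p))
    transfer i₀ j₀ fo ba (all φ) m h b =
      let a , m′ = extend ba (locals φ) (matched-sym m) b
      in transfer i₀ j₀ fo ba φ (matched-sym m′) (h a)

    comb-≡ₑ : ∀ {I J : Set} {A : I → Structure L} {B : J → Structure L}
              {C : I → J → Set} (i₀ : I) (j₀ : J) →
              Forth A B C → Forth B A (flip C) → Comb i₀ A ≡ₑ Comb j₀ B
    comb-≡ₑ {A = A} {B} {C} i₀ j₀ fo ba =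
      (λ {φ} → transfer i₀ j₀ fo ba φ start) ,
      (λ {φ} → transfer j₀ i₀ ba fo φ (matched-sym start))
      where
        start : ∀ {Δ} → Matched A B C Δ [] []
        start = record { same = λ () ; same⁻ = λ () ; colour = λ () ; block = λ () }

    -- Replacing components of a disjoint union

    avoid : ∀ {X : Set} (f : ℕ → X) → (∀ {m n} → f m ≡ f n → m ≡ n) →
            ∀ {n} (xs : Fin n → X) → ∃[ m ] (∀ k → xs k ≢ f m)
    avoid f inj {n} xs = stable λ ¬∃ →
      let hit : ∀ m → ∃[ k ] xs k ≡ f m
          hit m = stable λ ¬h → ¬∃ (m , λ k e → ¬h (k , e))
          k , l , k<l , e = pigeonhole (n<1+n n) (proj₁ ∘ hit ∘ toℕ)
      in <⇒≢ k<l (inj (trans (sym (proj₂ (hit (toℕ k))))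
                        (trans (cong xs e) (proj₂ (hit (toℕ l))))))

    Occurs : {I : Set} → (I → Structure L) → Sentence L → Sentence L → Set
    Occurs A φ₀ ψ = ∃[ i ] φ₀ ∈ Th (A i) × ψ ∈ Th (A i)

    Abundant : {I : Set} → (I → Structure L) → Sentence L → Set
    Abundant {I} A φ₀ =
      ∀ ψ → Occurs A φ₀ ψ → ∀ {n} (is : Fin n → I) →
      ∃[ i ] (∀ k → is k ≢ i) × φ₀ ∈ Th (A i) × ψ ∈ Th (A i)

    module _ {I J : Set} (A : I → Structure L) (B : J → Structure L)
             (φ₀ : Sentence L) where

      -- The irrelevant proof leaves a surviving component exactly one index. The factor `ℕ`
      -- supplies fresh partners on the new side, as `Abundant` does on the old one.
      Replaced : Set
      Replaced = [ i ∈ I ∣ φ₀ ∉ Th (A i) ] ⊎ (J × ℕ)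

      -- The components satisfying φ₀ are replaced by infinitely many copies
      -- of those in the family B.
      replace : Replaced → Structure L
      replace (inj₁ r)       = A (value r)
      replace (inj₂ (j , _)) = B j

      module _ (sat : ∀ j → φ₀ ∈ Th (B j))
               (occurs : ∀ j ψ → ψ ∈ Th (B j) → Occurs A φ₀ ψ)
               (dense : ∀ ψ → Occurs A φ₀ ψ → ∃[ j ] ψ ∈ Th (B j))
               (abundant : Abundant A φ₀) where

        private
          Colour : I → Replaced → Set
          Colour i (inj₁ r) = i ≡ value r
          Colour i (inj₂ _) = φ₀ ∈ Th (A i)

          agree-refl : ∀ {Δ : List (Sentence L)} {X : Structure L} → Agree Δ X [] X []
          agree-refl _ = id , id

          colour-unique : ∀ {i r} s → Colour i (inj₁ r) → Colour i s → s ≡ inj₁ r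
          colour-unique {r = _ , [ n ]} (inj₁ _) refl e =
            cong inj₁ (value-injective (sym e))
          colour-unique {r = _ , [ n ]} (inj₂ _) refl p = ⊥-elim-irr (n p)

          forth : Forth A replace Colour
          forth is js c Δ i fresh with em _ {P = φ₀ ∈ Th (A i)}
          ... | no ¬p = inj₁ (i , [ ¬p ]) ,
            (λ k e → fresh k (subst (Colour (is k)) e (c k))) ,
            refl , agree-refl {Δ}
          ... | yes p =
            let τ , _ , s , cτ = completion Δ (A i) []
                j , t = dense τ (i , p , s)
                m , new = avoid (λ m → inj₂ (j , m)) (λ { refl → refl }) js
            in inj₂ (j , m) , new , p , cτ (B j) [] t

          back : Forth replace A (flip Colour)
          back js is c Δ (inj₁ r) fresh =
            value r ,
            (λ k e → fresh k (colour-unique (js k) e (c k))) ,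
            refl , agree-refl {Δ}
          back js is c Δ (inj₂ (j , m)) fresh =
            let τ , _ , s , cτ = completion Δ (B j) []
                i , new , p , t = abundant τ (occurs j τ s) is
            in i , new , p , cτ (A i) [] t

        comb-replace : ∀ i₀ j₀ → Comb i₀ A ≡ₑ Comb (inj₂ (j₀ , 0)) replace
        comb-replace i₀ j₀ = comb-≡ₑ i₀ (inj₂ (j₀ , 0)) forth back

    -- E-classes

    iso-sat : (A B : Structure L) (f : Carrier A → Carrier B) →
              (∀ {x y} → f x ≡ f y → x ≡ y) → (∀ b → ∃[ a ] f a ≡ b) →
              (∀ {k} (R : Rel L k) v → interp A R v ⟺ interp B R (map f v)) →
              ∀ {n} (φ : Formula L n) ρ → Sat A ρ φ ⟺ Sat B (map f ρ) φ
    iso-sat A B f inj surj hom falsum ρ = id , id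
    iso-sat A B f inj surj hom (x == y) ρ
      rewrite lookup-map x f ρ | lookup-map y f ρ = cong f , inj
    iso-sat A B f inj surj hom (atom R xs) ρ
      rewrite trans (map-cong (λ x → lookup-map x f ρ) xs) (map-∘ f (lookup ρ) xs)
      = hom R (map (lookup ρ) xs)
    iso-sat A B f inj surj hom (φ ⇒ ψ) ρ =
      let p , p⁻ = iso-sat A B f inj surj hom φ ρ
          q , q⁻ = iso-sat A B f inj surj hom ψ ρ
      in (λ h → q ∘ h ∘ p⁻) , (λ h → q⁻ ∘ h ∘ p)
    iso-sat A B f inj surj hom (all φ) ρ =
      (λ h b → let a , e = surj b in
         subst (λ b → Sat B (b ∷ map f ρ) φ) e
           (proj₁ (iso-sat A B f inj surj hom φ (a ∷ ρ)) (h a))) ,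
      (λ h a → proj₂ (iso-sat A B f inj surj hom φ (a ∷ ρ)) (h (f a)))

    eclass-comb : ∀ {I : Set} (i₀ : I) (A : I → Structure L) i x r →
                  A i ≡ₑ EClass (Comb i₀ A) (i , x) r
    eclass-comb i₀ A i x r =
      (λ {φ} → proj₁ (sat φ [])) , (λ {φ} → proj₂ (sat φ []))
      where
        C : Structure L
        C = EClass (Comb i₀ A) (i , x) r
        f : Carrier (A i) → Carrier C
        f y = (i , y) , [ refl ]
        value-f : ∀ {k} (v : Vec (Carrier (A i)) k) → map value (map f v) ≡ map (i ,_) v
        value-f v = sym (map-∘ value f v)
        pairs-injective : ∀ {k} (v w : Vec (Carrier (A i)) k) →
                          _≡_ {A = Vec (Σ _ (Carrier ∘ A)) k}
                            (map (i ,_) v) (map (i ,_) w) → v ≡ w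
        pairs-injective []       []       _ = refl
        pairs-injective (y ∷ v) (z ∷ w) e =
          cong₂ _∷_ (,-injʳ (∷-injectiveˡ e)) (pairs-injective v w (∷-injectiveʳ e))
        hom⁻ : ∀ {k} (R : Rel L k) v → interp C R (map f v) → interp (A i) R v
        hom⁻ R (y ∷ v) (j , u ∷ w , e , s) with cong proj₁ (∷-injectiveˡ e)
        ... | refl = subst (interp (A i) R)
          (sym (pairs-injective (y ∷ v) (u ∷ w) (trans (sym (value-f (y ∷ v))) e))) s
        surj : ∀ c → ∃[ y ] f y ≡ c
        surj ((j , y) , [ p ]) with recompute (em _) p
        ... | refl = y , refl
        sat : ∀ {n} (φ : Formula L n) ρ → Sat (A i) ρ φ ⟺ Sat C (map f ρ) φ
        sat = iso-sat (A i) C f (,-injʳ ∘ cong value) surj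
          (λ R v → (λ s → i , v , value-f v , s) , hom⁻ R v)

    -- The last variable is the parameter a whose E-class is meant.
    relativise : ∀ {n} → Formula L n → Formula (L +E) (n + 1)
    relativise falsum      = falsum
    relativise (x == y)    = (x ↑ˡ 1) == (y ↑ˡ 1)
    relativise (atom R xs) = atom (base R) (map (_↑ˡ 1) xs)
    relativise (φ ⇒ ψ)     = relativise φ ⇒ relativise ψ
    relativise {n} (all φ) = all (atom E ((suc n ↑ʳ zero) ∷ zero ∷ []) ⇒ relativise φ)

    sat-relativise : ∀ (M : Structure (L +E)) a r {n} (φ : Formula L n) ρ →
                     Sat (EClass M a r) ρ φ ⟺
                     Sat M (map value ρ ++ a ∷ []) (relativise φ)
    sat-relativise M a r falsum ρ = id , id
    sat-relativise M a r (x == y) ρ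
      rewrite lookup-++ˡ (map value ρ) (a ∷ []) x | lookup-++ˡ (map value ρ) (a ∷ []) y
            | lookup-map x value ρ | lookup-map y value ρ
      = cong value , value-injective
    sat-relativise M a r (atom R xs) ρ =
      subst (interp M (base R)) eq , subst (interp M (base R)) (sym eq)
      where
        eq : map value (map (lookup ρ) xs) ≡
             map (lookup (map value ρ ++ a ∷ [])) (map (_↑ˡ 1) xs)
        eq = trans (sym (map-∘ value (lookup ρ) xs))
               (trans (map-cong (λ x → sym (trans (lookup-++ˡ (map value ρ) (a ∷ []) x)
                                              (lookup-map x value ρ))) xs)
                 (map-∘ _ (_↑ˡ 1) xs))
    sat-relativise M a r (φ ⇒ ψ) ρ =
      let p , p⁻ = sat-relativise M a r φ ρ
          q , q⁻ = sat-relativise M a r ψ ρ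
      in (λ h → q ∘ h ∘ p⁻) , (λ h → q⁻ ∘ h ∘ p)
    sat-relativise M a r {n} (all φ) ρ
      rewrite lookup-++ʳ (map value ρ) (a ∷ []) zero =
      (λ h b e → proj₁ (sat-relativise M a r φ ((b , [ e ]) ∷ ρ)) (h (b , [ e ]))) ,
      λ { h (b , [ e ]) → proj₂ (sat-relativise M a r φ ((b , [ e ]) ∷ ρ))
                            (h b (recompute (em _) e)) }

    someClass : Sentence L → Sentence (L +E)
    someClass φ = ex (conj (atom E (zero ∷ zero ∷ [])) (relativise φ))

    someClass⁺ : ∀ M a r φ → φ ∈ Th (EClass M a r) → someClass φ ∈ Th M
    someClass⁺ M a r φ s h =
      h a (conj⁺ M (a ∷ []) (atom E (zero ∷ zero ∷ [])) (relativise φ) r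
            (proj₁ (sat-relativise M a r φ []) s))

    someClass⁻ : ∀ M φ → someClass φ ∈ Th M → ∃[ a ] ∃[ r ] φ ∈ Th (EClass M a r)
    someClass⁻ M φ s =
      let a , t = ex⁻ M [] (conj (atom E (zero ∷ zero ∷ [])) (relativise φ)) s
          r , u = conj⁻ M (a ∷ []) (atom E (zero ∷ zero ∷ [])) (relativise φ) t
      in a , r , proj₂ (sat-relativise M a r φ []) u

    hasTheory : ∀ {A : Structure L} (T : Theory L) → A ⊨ T → A HasTheory T
    hasTheory T m = m , λ {φ} p → [ id , (λ n → contradiction p (m n)) ]′ (complete T φ)

    model : (T : Theory L) → ∃[ A ] A HasTheory T
    model T = let A , m = satisfiable T in A , hasTheory {A} T m

    theoryOf : Structure L → Theory L
    theoryOf A = record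
      { sentences   = Th A
      ; satisfiable = A , id
      ; complete    = λ φ → [ inj₁ , inj₂ ]′ (toSum (em _ {P = φ ∈ Th A}))
      }

    -- `Cl-E` as topological closure

    Closure : Theories L → Theories L
    Closure S T = ∀ φ → φ ∈ sentences T → Σ[ T′ ∈ Theory L ] T′ ∈ S × φ ∈ sentences T′

    isClassTheory⁺ : ∀ {I : Set} (i₀ : I) (A : I → Structure L) i T →
                     A i HasTheory T → IsClassTheory (Comb i₀ A) T
    isClassTheory⁺ i₀ A i T (p , q) =
      let x = point (A i)
          eq = eclass-comb i₀ A i x refl
      in (i , x) , refl , (λ {φ} s → proj₁ eq {φ} (p s)) , (λ {φ} s → q (proj₂ eq {φ} s))

    isClassTheory⁻ : ∀ {I : Set} (i₀ : I) (A : I → Structure L) T →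
                     IsClassTheory (Comb i₀ A) T → ∃[ i ] A i HasTheory T
    isClassTheory⁻ i₀ A T ((i , x) , r , p , q) =
      let eq = eclass-comb i₀ A i x r
      in i , (λ {φ} s → proj₂ eq {φ} (p s)) , (λ {φ} s → q (proj₁ eq {φ} s))

    -- That some class satisfies `φ` is itself a first-order sentence over `L +E`, so elementary
    -- equivalence preserves it.
    classTheory-occurs : ∀ {I : Set} (i₀ : I) (A : I → Structure L) M T →
                         M ≡ₑ Comb i₀ A → IsClassTheory M T →
                         ∀ φ → φ ∈ sentences T → ∃[ i ] φ ∈ Th (A i)
    classTheory-occurs i₀ A M T (to , _) (a , r , p , _) φ φ∈ =
      let (i , x) , r′ , s = someClass⁻ (Comb i₀ A) φ
            (to {someClass φ} (someClass⁺ M a r φ (p φ∈)))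
      in i , proj₂ (eclass-comb i₀ A i x r′) {φ} s

    Cl-E⊆Closure : (S : Theories L) → Cl-E S ⊆ Closure S
    Cl-E⊆Closure S {T} (I , i₀ , A , th , M , eq , c) φ φ∈ =
      let i , s = classTheory-occurs i₀ A M T eq c φ φ∈
          T′ , T′∈ , _ , q = th i
      in T′ , T′∈ , q s

    -- One approximating theory from `S` is taken for each sentence of `T`, in infinitely many
    -- copies; adjoining a model of `T` then leaves the theory of the combination unchanged. With
    -- `truth` as `φ₀`, all components count as replaced.
    Closure⊆Cl-E : (S : Theories L) → Closure S ⊆ Cl-E S
    Closure⊆Cl-E S {T} cl =
      (I × ℕ) , (i₀ , 0) , A ∘ proj₁ ,
      (λ (i , _) → let T′ , T′∈ , _ = approx i in T′ , T′∈ , proj₂ (model T′)) ,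
      Comb (inj₂ (inj₂ tt , 0)) (replace (A ∘ proj₁) B truth) ,
      swap (comb-replace (A ∘ proj₁) B truth (λ _ → id) occurs dense abundant
              (i₀ , 0) (inj₂ tt)) ,
      isClassTheory⁺ (inj₂ (inj₂ tt , 0)) (replace (A ∘ proj₁) B truth)
        (inj₂ (inj₂ tt , 0)) T (proj₂ (model T))
      where
        I : Set
        I = Σ[ φ ∈ Sentence L ] φ ∈ sentences T
        i₀ : I
        i₀ = truth , proj₂ (proj₂ (model T)) id
        approx : (i : I) → Σ[ T′ ∈ Theory L ] T′ ∈ S × proj₁ i ∈ sentences T′
        approx (φ , φ∈) = cl φ φ∈
        A : I → Structure L
        A i = proj₁ (model (proj₁ (approx i)))
        B : I ⊎ ⊤ → Structure L
        B (inj₁ i) = A i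
        B (inj₂ _) = proj₁ (model T)
        occurs : ∀ j ψ → ψ ∈ Th (B j) → Occurs (A ∘ proj₁) truth ψ
        occurs (inj₁ i) ψ s = (i , 0) , id , s
        occurs (inj₂ _) ψ s =
          let ψ∈ = proj₂ (proj₂ (model T)) s
              T′ , _ , ψ∈′ = cl ψ ψ∈
          in ((ψ , ψ∈) , 0) , id , proj₁ (proj₂ (model T′)) ψ∈′
        dense : ∀ ψ → Occurs (A ∘ proj₁) truth ψ → ∃[ j ] ψ ∈ Th (B j)
        dense ψ ((i , _) , _ , s) = inj₁ i , s
        abundant : Abundant (A ∘ proj₁) truth
        abundant ψ ((i , _) , _ , s) is =
          let m , new = avoid (λ m → (i , m)) (λ { refl → refl }) is
          in (i , m) , new , id , s

  -- Brings a proposition of any universe level down to a Boolean, so that power sets stay in `Set`.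
  holds : ∀ {p} → Set p → Bool
  holds P = does (em _ {P = P})

  holds⁺ : ∀ {p} {P : Set p} → P → holds P ≡ true
  holds⁺ {P = P} p with em _ {P = P}
  ... | yes _ = refl
  ... | no ¬p = contradiction p ¬p

  holds⁻ : ∀ {p} {P : Set p} → holds P ≡ true → P
  holds⁻ {P = P} e with em _ {P = P}
  ... | yes p = p

  module _ (ext : ∀ a b → Extensionality a b) where

    subset-ext : ∀ {A : Set} {x y : A → Bool} → (∀ a → x a ≡ true → y a ≡ true) →
                 (∀ a → y a ≡ true → x a ≡ true) → x ≡ y
    subset-ext p q = ext _ _ λ a → ⇔→≡ (mk⇔ (p a) (q a))

    -- Ultraproducts

    -- The Teichmüller–Tukey lemma.  The least tower of sets closed under next
    -- and unions is a chain, by the argument of Bourbaki and Witt, so that its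
    -- union is a fixed point of next.
    module Tukey {A : Set} (Ok : List A → Set) (ok-[] : Ok []) where

      _⊑_ : (A → Bool) → (A → Bool) → Set
      x ⊑ y = ∀ a → x a ≡ true → y a ≡ true

      Good : (A → Bool) → Set
      Good x = ∀ l → (∀ {a} → a ∈ˡ l → x a ≡ true) → Ok l

      insert : A → (A → Bool) → A → Bool
      insert a x b = holds (x b ≡ true ⊎ b ≡ a)

      ⋃ : {J : Set} → (J → A → Bool) → A → Bool
      ⋃ F a = holds (∃[ j ] F j a ≡ true)

      Extendable : (A → Bool) → Set
      Extendable x = ∃[ a ] x a ≢ true × Good (insert a x)

      next′ : ∀ x → Dec (Extendable x) → A → Bool
      next′ x (yes (a , _)) = insert a x
      next′ x (no _)        = x

      next : (A → Bool) → A → Bool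
      next x = next′ x (em _)

      data Tower : (A → Bool) → Set₁ where
        step  : ∀ {x} → Tower x → Tower (next x)
        union : {J : Set} (F : J → A → Bool) → (∀ j → Tower (F j)) → Tower (⋃ F)

      ⊑-trans : ∀ {x y z} → x ⊑ y → y ⊑ z → x ⊑ z
      ⊑-trans p q a = q a ∘ p a

      ⊑-antisym : ∀ {x y} → x ⊑ y → y ⊑ x → x ≡ y
      ⊑-antisym = subset-ext

      ⊑-next : ∀ x → x ⊑ next x
      ⊑-next x = go (em _)
        where
          go : ∀ d → x ⊑ next′ x d
          go (yes _) a e = holds⁺ (inj₁ e)
          go (no _)  a e = e

      ⊑-⋃ : ∀ {J : Set} (F : J → A → Bool) j → F j ⊑ ⋃ F
      ⊑-⋃ F j a e = holds⁺ (j , e)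

      ⋃-⊑ : ∀ {J : Set} (F : J → A → Bool) {y} → (∀ j → F j ⊑ y) → ⋃ F ⊑ y
      ⋃-⊑ F p a e = let j , e′ = holds⁻ e in p j a e′

      Extreme : (A → Bool) → Set₁
      Extreme x = ∀ {y} → Tower y → y ⊑ x → ¬ x ⊑ y → next y ⊑ x

      -- Induction on the tower of `y`: from strictly below `x` a step cannot leap past `x`, by
      -- extremeness, and from `x` itself it leads to `next x`.
      dichotomy : ∀ {x} → Extreme x → ∀ {y} → Tower y → y ⊑ x ⊎ next x ⊑ y
      dichotomy {x} ex-x (step {y} t) with dichotomy ex-x t
      ... | inj₂ q = inj₂ (⊑-trans q (⊑-next y))
      ... | inj₁ p with em _ {P = x ⊑ y}
      ...   | yes q = inj₂ (subst (λ z → next x ⊑ next z) (⊑-antisym q p) (λ _ → id))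
      ...   | no ¬q = inj₁ (ex-x t p ¬q)
      dichotomy {x} ex-x (union F ts) with em _ {P = ∃[ j ] next x ⊑ F j}
      ... | yes (j , q) = inj₂ (⊑-trans q (⊑-⋃ F j))
      ... | no ¬q = inj₁ (⋃-⊑ F λ j →
        [ id , (λ q → contradiction (j , q) ¬q) ]′ (dichotomy ex-x (ts j)))

      extreme : ∀ {x} → Tower x → Extreme x
      extreme (step {x} t) {y} u y⊑ ¬⊑y with dichotomy (extreme t) u
      ... | inj₂ q = contradiction q ¬⊑y
      ... | inj₁ p with em _ {P = x ⊑ y}
      ...   | yes q = subst (λ z → next z ⊑ next x) (⊑-antisym q p) (λ _ → id)
      ...   | no ¬q = ⊑-trans (extreme t u p ¬q) (⊑-next x)
      extreme (union F ts) {y} u y⊑ ¬⊑y with em _ {P = ∃[ j ] y ⊑ F j}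
      ... | no ¬p = contradiction (⋃-⊑ F λ j →
        [ (λ p → contradiction (j , p) ¬p) , ⊑-trans (⊑-next (F j)) ]′
          (dichotomy (extreme (ts j)) u)) ¬⊑y
      ... | yes (j , p) with em _ {P = F j ⊑ y}
      ...   | no ¬q = ⊑-trans (extreme (ts j) u p ¬q) (⊑-⋃ F j)
      ...   | yes q with ⊑-antisym p q
      ...     | refl = [ (λ r → contradiction r ¬⊑y) , id ]′
        (dichotomy (extreme (ts j)) (union F ts))

      chain : ∀ {x y} → Tower x → Tower y → x ⊑ y ⊎ y ⊑ x
      chain {x} t u with dichotomy (extreme t) u
      ... | inj₁ p = inj₂ p
      ... | inj₂ q = inj₁ (⊑-trans (⊑-next x) q)

      -- Why a condition of finite character survives unions: a finite part of the union of a chain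
      -- lies in one member. The empty list is separate because `J` may be empty.
      gather : ∀ {J : Set} (F : J → A → Bool) → (∀ j → Tower (F j)) →
               ∀ l → (∀ {a} → a ∈ˡ l → ⋃ F a ≡ true) →
               l ≡ [] ⊎ ∃[ j ] (∀ {a} → a ∈ˡ l → F j a ≡ true)
      gather F ts [] h = inj₁ refl
      gather F ts (a ∷ l) h with holds⁻ (h (here refl)) | gather F ts l (h ∘ there)
      ... | j , e | inj₁ refl = inj₂ (j , λ { (here refl) → e })
      ... | j , e | inj₂ (k , hk) with chain (ts j) (ts k)
      ...   | inj₁ p = inj₂ (k , λ { (here refl) → p _ e ; (there b∈) → hk b∈ })
      ...   | inj₂ p = inj₂ (j , λ { (here refl) → e ; (there b∈) → p _ (hk b∈) })

      tower-good : ∀ {x} → Tower x → Good x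
      tower-good (step {x} t) = go (em _)
        where
          go : ∀ d → Good (next′ x d)
          go (yes (_ , _ , g)) = g
          go (no _)            = tower-good t
      tower-good (union F ts) l h with gather F ts l h
      ... | inj₁ refl    = ok-[]
      ... | inj₂ (j , g) = tower-good (ts j) l g

      tukey : ∃[ x ] Good x × (∀ a → Good (insert a x) → x a ≡ true)
      tukey = top , tower-good top-tower , maximal
        where
          -- The whole tower must be indexed by a type in `Set`, although `Tower` lives one level
          -- higher; `holds` makes the condition small.
          J : Set
          J = Σ[ x ∈ (A → Bool) ] holds (Tower x) ≡ true
          top : A → Bool
          top = ⋃ {J} proj₁
          top-tower : Tower top
          top-tower = union {J} proj₁ (λ j → holds⁻ (proj₂ j))
          closed : next top ⊑ top
          closed = ⊑-⋃ {J} proj₁ (next top , holds⁺ (step top-tower))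
          saturated : ∀ d → next′ top d ⊑ top → ¬ Extendable top
          saturated (yes (a , ¬e , _)) p _ = ¬e (p a (holds⁺ (inj₂ refl)))
          saturated (no ¬e)            p   = ¬e
          maximal : ∀ a → Good (insert a top) → top a ≡ true
          maximal a g = stable λ ¬e → saturated (em _) closed (a , ¬e , g)

    -- By large-∃ the ultrafilter is non-principal.
    record Ultrafilter : Set₁ where
      field
        Large    : (ℕ → Set) → Set
        large-mp : ∀ {P Q R : ℕ → Set} → (∀ n → P n → Q n → R n) →
                   Large P → Large Q → Large R
        large-¬  : ∀ {P : ℕ → Set} → ¬ Large P → Large (λ n → ¬ P n)
        large-∃  : ∀ {P : ℕ → Set} → Large P → ∀ m → ∃[ n ] m ≤ n × P n

      large-map : ∀ {P Q : ℕ → Set} → (∀ n → P n → Q n) → Large P → Large Q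
      large-map f p = large-mp (λ n q _ → f n q) p p

      large-tail : ∀ m → Large (m ≤_)
      large-tail m = stable λ ¬l →
        let n , m≤n , m≰n = large-∃ (large-¬ ¬l) m in m≰n m≤n

      large-all : ∀ {P : ℕ → Set} → (∀ n → P n) → Large P
      large-all p = large-map (λ n _ → p n) (large-tail 0)

    -- Asking for infinitely many common points instead of one makes a maximal family a
    -- non-principal ultrafilter.
    Unbounded : List (ℕ → Bool) → Set
    Unbounded l = ∀ m → ∃[ n ] m ≤ n × (∀ {P} → P ∈ˡ l → P n ≡ true)

    open Tukey Unbounded (λ m → m , ≤-refl , λ ())

    module Maximal (U : (ℕ → Bool) → Bool) (good : Good U)
                   (maximal : ∀ P → Good (insert P U) → U P ≡ true) where

      clash : ∀ {b} → b ≡ true → not b ≡ true → ⊥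
      clash refl ()

      strip : ∀ P l → (∀ {Q} → Q ∈ˡ l → insert P U Q ≡ true) →
              ∃[ gs ] (∀ {Q} → Q ∈ˡ gs → U Q ≡ true) ×
                (∀ n → (∀ {Q} → Q ∈ˡ gs → Q n ≡ true) → P n ≡ true →
                       ∀ {Q} → Q ∈ˡ l → Q n ≡ true)
      strip P [] h = [] , (λ ()) , λ _ _ _ ()
      strip P (Q ∷ l) h with holds⁻ (h (here refl)) | strip P l (h ∘ there)
      ... | inj₁ e    | gs , g , c =
        Q ∷ gs , (λ { (here refl) → e ; (there R∈) → g R∈ }) ,
        λ { n k p (here refl) → k (here refl)
          ; n k p (there R∈) → c n (k ∘ there) p R∈ }
      ... | inj₂ refl | gs , g , c =
        gs , g , λ { n k p (here refl) → p ; n k p (there R∈) → c n k p R∈ }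

      -- That `P` cannot be added to `U` has a finite witness: members of `U` whose common part
      -- meets `P` only below a bound. Witnesses for `P` and for its complement together contradict
      -- `good`.
      refute : ∀ P → U P ≢ true →
               ∃[ gs ] (∀ {Q} → Q ∈ˡ gs → U Q ≡ true) ×
                 (∃[ m ] ∀ n → m ≤ n → (∀ {Q} → Q ∈ˡ gs → Q n ≡ true) → P n ≢ true)
      refute P ¬u = stable λ ¬r → ¬u (maximal P λ l h m → stable λ ¬n →
        let gs , g , c = strip P l h
        in ¬r (gs , g , m , λ n m≤n k p → ¬n (n , m≤n , c n k p)))

      decide : ∀ {P : ℕ → Bool} → U P ≢ true → U (λ n → not (P n)) ≡ true
      decide {P} ¬p = stable λ ¬q →
        let gs , g , m , c  = refute P ¬p
            hs , h , m′ , d = refute (λ n → not (P n)) ¬q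
            n , m⊔m′≤n , k = good (gs List.++ hs)
              (λ Q∈ → [ g , h ]′ (∈-++⁻ gs Q∈)) (m ⊔ m′)
        in d n (≤-trans (m≤n⊔m m m′) m⊔m′≤n) (k ∘ ∈-++⁺ʳ gs)
             (cong not (¬-not (c n (≤-trans (m≤m⊔n m m′) m⊔m′≤n) (k ∘ ∈-++⁺ˡ))))

      toUltrafilter : Ultrafilter
      toUltrafilter = record
        { Large    = λ P → U (λ n → holds (P n)) ≡ true
        ; large-mp = λ {P} {Q} {R} f p q → stable λ ¬r →
            let l = (λ n → holds (P n)) ∷ (λ n → holds (Q n)) ∷
                    (λ n → not (holds (R n))) ∷ []
                n , _ , h = good l (λ { (here refl) → p
                                      ; (there (here refl)) → q
                                      ; (there (there (here refl))) → decide ¬r }) 0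
            in clash (holds⁺ (f n (holds⁻ (h (here refl))) (holds⁻ (h (there (here refl))))))
                     (h (there (there (here refl))))
        ; large-¬  = λ {P} ¬p → stable λ ¬q →
            let l = (λ n → not (holds (P n))) ∷ (λ n → not (holds (¬ P n))) ∷ []
                n , _ , h = good l (λ { (here refl) → decide ¬p
                                      ; (there (here refl)) → decide ¬q }) 0
            in clash (holds⁺ {P = ¬ P n} λ p → clash (holds⁺ p) (h (here refl)))
                     (h (there (here refl)))
        ; large-∃  = λ {P} p m →
            let n , m≤n , h = good ((λ n → holds (P n)) ∷ [])
                                (λ { (here refl) → p }) m
            in n , m≤n , holds⁻ (h (here refl))
        }

    ultrafilter : Ultrafilter
    ultrafilter = let U , good , maximal = tukey in Maximal.toUltrafilter U good maximal

    module Ultraproduct (𝒰 : Ultrafilter) {L : Language} (A : ℕ → Structure L) where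

      open Ultrafilter 𝒰

      Seq : Set
      Seq = ∀ n → Carrier (A n)

      _∼_ : Seq → Seq → Set
      f ∼ g = Large (λ n → f n ≡ g n)

      pick : (Seq → Bool) → Seq
      pick c with em _ {P = ∃[ f ] c f ≡ true}
      ... | yes (f , _) = f
      ... | no _        = λ n → point (A n)

      pick∈ : ∀ (c : Seq → Bool) {f} → c f ≡ true → c (pick c) ≡ true
      pick∈ c {f} e with em _ {P = ∃[ f ] c f ≡ true}
      ... | yes (_ , e′) = e′
      ... | no ¬∃        = contradiction (f , e) ¬∃

      -- The quotient by ∼ is the set of those sequences that are the chosen
      -- representatives of their classes.
      rep : Seq → Seq
      rep f = pick (λ g → holds (f ∼ g))

      ∼-rep : ∀ f → f ∼ rep f
      ∼-rep f = holds⁻ (pick∈ (λ g → holds (f ∼ g)) {f} (holds⁺ (large-all (λ _ → refl))))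

      rep-cong : ∀ {f g} → f ∼ g → rep f ≡ rep g
      rep-cong {f} {g} p = cong pick (subset-ext
        (λ h e → holds⁺ (large-mp (λ _ p q → trans (sym p) q) p (holds⁻ {P = f ∼ h} e)))
        (λ h e → holds⁺ (large-mp (λ _ p q → trans p q) p (holds⁻ {P = g ∼ h} e))))

      Element : Set
      Element = Σ[ f ∈ Seq ] rep f ≡ f

      class : Seq → Element
      class f = rep f , sym (rep-cong (∼-rep f))

      element-≡ : ∀ {p q : Element} → proj₁ p ≡ proj₁ q → p ≡ q
      element-≡ {f , p} {_ , q} refl = cong (f ,_) (≡-irrelevant p q)

      class-surjective : ∀ p → class (proj₁ p) ≡ p
      class-surjective (f , e) = element-≡ e

      ultraproduct : Structure L
      ultraproduct .Carrier = Element
      ultraproduct .point   = class (λ n → point (A n))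
      ultraproduct .interp R v =
        Large (λ n → interp (A n) R (map (λ p → proj₁ p n) v))

      at : ∀ {k} n → Vec Seq k → Vec (Carrier (A n)) k
      at n = map (λ f → f n)

      at-class : ∀ {k m} (ρ : Vec Seq k) (xs : Vec (Fin k) m) →
                 Large (λ n → map (λ p → proj₁ p n) (map (lookup (map class ρ)) xs) ≡
                              map (lookup (at n ρ)) xs)
      at-class ρ []       = large-all (λ _ → refl)
      at-class ρ (x ∷ xs) = large-mp
        (λ n e es → cong₂ _∷_ (trans (cong (λ p → proj₁ p n) (lookup-map x class ρ))
                                (trans (sym e) (sym (lookup-map x (λ f → f n) ρ)))) es)
        (∼-rep (lookup ρ x)) (at-class ρ xs)

      łoś : ∀ {k} (φ : Formula L k) ρ →
            Sat ultraproduct (map class ρ) φ ⟺ Large (λ n → Sat (A n) (at n ρ) φ)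
      łoś falsum ρ = (λ ()) , λ l → proj₂ (proj₂ (large-∃ l 0))
      łoś (x == y) ρ
        rewrite lookup-map x class ρ | lookup-map y class ρ =
        (λ e → large-mp
          (λ n p q → trans (lookup-map x (λ f → f n) ρ)
            (trans p (trans (cong (λ r → proj₁ r n) e)
              (trans (sym q) (sym (lookup-map y (λ f → f n) ρ))))))
          (∼-rep (lookup ρ x)) (∼-rep (lookup ρ y))) ,
        λ l → element-≡ (rep-cong (large-map
          (λ n e → trans (sym (lookup-map x (λ f → f n) ρ))
            (trans e (lookup-map y (λ f → f n) ρ))) l))
      łoś (atom R xs) ρ =
        large-mp (λ n → subst (interp (A n) R)) (at-class ρ xs) ,
        large-mp (λ n → subst (interp (A n) R) ∘ sym) (at-class ρ xs)
      łoś (φ ⇒ ψ) ρ =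
        let p , p⁻ = łoś φ ρ
            q , q⁻ = łoś ψ ρ
        in (λ h → stable λ ¬l →
              let s = p⁻ (stable λ ¬s → ¬l (large-map (λ n ¬φ φ → contradiction φ ¬φ) (large-¬ ¬s)))
              in ¬l (large-map (λ n ψ _ → ψ) (q (h s)))) ,
           λ l s → q⁻ (large-mp (λ n f x → f x) l (p s))
      łoś (all φ) ρ =
        (λ h → stable λ ¬l →
           let n , _ , s , ¬∀ = large-∃
                 {P = λ n → Sat (A n) (bad n ∷ at n ρ) φ × ¬ (∀ a → Sat (A n) (a ∷ at n ρ) φ)}
                 (large-mp (λ n → _,_) (proj₁ (łoś φ (bad ∷ ρ)) (h (class bad))) (large-¬ ¬l)) 0
           in bad-fails n ¬∀ s) ,
        λ l p → subst (λ p → Sat ultraproduct (p ∷ map class ρ) φ) (class-surjective p)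
          (proj₂ (łoś φ (proj₁ p ∷ ρ)) (large-map (λ n h → h (proj₁ p n)) l))
        where
          Bad : ∀ n → Carrier (A n) → Set
          Bad n a = ¬ Sat (A n) (a ∷ at n ρ) φ
          -- A counterexample at each index that has one. The default is harmless, as `bad n` is
          -- only examined where the universal formula fails.
          bad : Seq
          bad n with em _ {P = ∃ (Bad n)}
          ... | yes (a , _) = a
          ... | no _        = point (A n)
          bad-fails : ∀ n → ¬ (∀ a → Sat (A n) (a ∷ at n ρ) φ) → Bad n (bad n)
          bad-fails n ¬∀ with em _ {P = ∃ (Bad n)}
          ... | yes (_ , b) = b
          ... | no ¬∃       = contradiction (λ a → stable λ ¬s → ¬∃ (a , ¬s)) ¬∀

      limit-holds : ∀ φ m → (∀ n → m ≤ n → φ ∈ Th (A n)) → φ ∈ Th ultraproduct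
      limit-holds φ m h = proj₂ (łoś φ []) (large-map h (large-tail m))

      limit-occurs : ∀ φ → φ ∈ Th ultraproduct → ∃[ n ] φ ∈ Th (A n)
      limit-occurs φ s = let n , _ , t = large-∃ (proj₁ (łoś φ []) s) 0 in n , t

    -- Perfect sets of theories

    ≡ₑ-sym : ∀ {L} {X Y : Structure L} → X ≡ₑ Y → Y ≡ₑ X
    ≡ₑ-sym = swap

    ≡ₑ-trans : ∀ {L} {X Y Z : Structure L} → X ≡ₑ Y → Y ≡ₑ Z → X ≡ₑ Z
    ≡ₑ-trans (p , q) (p′ , q′) = (λ {φ} s → p′ {φ} (p {φ} s)) , (λ {φ} s → q {φ} (q′ {φ} s))

    module _ {L : Language} where

      literal : Sentence L → Bool → Sentence L
      literal χ true  = χ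
      literal χ false = neg χ

      literal-unique : ∀ X χ b b′ → literal χ b ∈ Th X → literal χ b′ ∈ Th X → b ≡ b′
      literal-unique X χ true  true  _ _  = refl
      literal-unique X χ true  false s ¬s = contradiction s ¬s
      literal-unique X χ false true  ¬s s = contradiction s ¬s
      literal-unique X χ false false _ _  = refl

      literal-holds : ∀ X χ → literal χ (holds (χ ∈ Th X)) ∈ Th X
      literal-holds X χ with em _ {P = χ ∈ Th X}
      ... | yes s = s
      ... | no ¬s = ¬s

    -- Coding binary sequences and words

    prefix : (ℕ → Bool) → ℕ → List Bool
    prefix α zero    = []
    prefix α (suc n) = α n ∷ prefix α n

    merge : (ℕ → Bool) → (ℕ → Bool) → ℕ → Bool
    merge α β zero    = α zero
    merge α β (suc n) = merge β (α ∘ suc) n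

    double : ℕ → ℕ
    double zero    = zero
    double (suc n) = suc (suc (double n))

    merge-even : ∀ α β n → merge α β (double n) ≡ α n
    merge-even α β zero    = refl
    merge-even α β (suc n) = merge-even (α ∘ suc) (β ∘ suc) n

    merge-odd : ∀ α β n → merge α β (suc (double n)) ≡ β n
    merge-odd α β n = merge-even β (α ∘ suc) n

    -- `ℕᵇ` is bijective base two, so different words are different numerals.
    binary : List Bool → ℕᵇ
    binary []          = ℕᵇ.zero
    binary (true ∷ s)  = 2[1+ binary s ]
    binary (false ∷ s) = 1+[2 binary s ]

    binary-injective : ∀ s t → binary s ≡ binary t → s ≡ t
    binary-injective []          []          _ = refl
    binary-injective []          (true ∷ _)  ()
    binary-injective []          (false ∷ _) ()
    binary-injective (true ∷ s)  (true ∷ t)  e =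
      cong (true ∷_) (binary-injective s t (2[1+_]-injective e))
    binary-injective (false ∷ s) (false ∷ t) e =
      cong (false ∷_) (binary-injective s t (1+[2_]-injective e))

    encode : List Bool → ℕ
    encode = toℕᵇ ∘ binary

    encode-injective : ∀ s t → encode s ≡ encode t → s ≡ t
    encode-injective s t e = binary-injective s t (toℕ-injective e)

    -- The Cantor scheme in a perfect set

    module Scattered
      {L : Language} {I : Set} (A : I → Structure L) (φ₀ : Sentence L)
      (inhabited : ∃[ i ] φ₀ ∈ Th (A i))
      (perfect : ∀ ψ → Occurs A φ₀ ψ →
         ∃[ χ ] Occurs A φ₀ (conj ψ χ) × Occurs A φ₀ (conj ψ (neg χ))) where

      Limit : Structure L → Set
      Limit Y = ∀ ψ → ψ ∈ Th Y → Occurs A φ₀ ψ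

      limit-φ₀ : ∀ {Y} → Limit Y → φ₀ ∈ Th Y
      limit-φ₀ lim = stable λ ¬p → let _ , p , q = lim (neg φ₀) ¬p in q p

      abstract
        -- Compactness along sequences: an ultraproduct inherits what holds eventually, and what it
        -- satisfies holds in some factor, which makes it a limit.
        sequence-limit : (is : ℕ → I) → (∀ n → φ₀ ∈ Th (A (is n))) →
                         ∃[ Z ] Limit Z ×
                           (∀ ψ m → (∀ n → m ≤ n → ψ ∈ Th (A (is n))) → ψ ∈ Th Z)
        sequence-limit is p =
          ultraproduct ,
          (λ ψ s → let n , t = limit-occurs ψ s in is n , p n , t) ,
          limit-holds
          where
            open Ultraproduct ultrafilter (A ∘ is)

      Node : Set
      Node = ∃ (Occurs A φ₀)

      root : Node
      root = truth , proj₁ inhabited , proj₂ inhabited , id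

      cut : Node → Sentence L
      cut (ψ , o) = proj₁ (perfect ψ o)

      child : Node → Bool → Node
      child (ψ , o) b = conj ψ (literal (cut (ψ , o)) b) , occurs b
        where
          occurs : ∀ b → Occurs A φ₀ (conj ψ (literal (cut (ψ , o)) b))
          occurs true  = proj₁ (proj₂ (perfect ψ o))
          occurs false = proj₂ (proj₂ (perfect ψ o))

      descend : Node → List Bool → Node
      descend N []      = N
      descend N (b ∷ s) = child (descend N s) b

      at : Node → (ℕ → Bool) → ℕ → Sentence L
      at N α n = proj₁ (descend N (prefix α n))

      Passes : Node → (ℕ → Bool) → Structure L → Set
      Passes N α Y = ∀ n → at N α n ∈ Th Y

      at-anti : ∀ N α X {m n} → m ≤′ n → at N α n ∈ Th X → at N α m ∈ Th X
      at-anti N α X ≤′-refl s = s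
      at-anti N α X (≤′-step {n} m≤n) s =
        at-anti N α X m≤n (proj₁ (conj⁻ X [] (at N α n)
          (literal (cut (descend N (prefix α n))) (α n)) s))

      -- Siblings carry contradictory literals, so a theory determines its branch. With `follow` and
      -- `branch` this projects the limits in `N` onto Cantor space.
      passes-unique : ∀ N {α β} X → Passes N α X → Passes N β X → α ≗ β
      passes-unique N {α} {β} X p q n = ∷ˡ-injectiveˡ (agree (suc n))
        where
          agree : ∀ n → prefix α n ≡ prefix β n
          agree zero    = refl
          agree (suc n) with prefix α n | agree n | p (suc n) | q (suc n)
          ... | _ | refl | s | t = cong (_∷ _)
            (literal-unique X (cut D) (α n) (β n)
              (proj₂ (conj⁻ X [] (proj₁ D) (literal (cut D) (α n)) s))
              (proj₂ (conj⁻ X [] (proj₁ D) (literal (cut D) (β n)) t)))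
            where
              D : Node
              D = descend N (prefix β n)

      follow : ∀ N X → proj₁ N ∈ Th X → ∃[ α ] Passes N α X
      follow N X s₀ = α , λ n →
        subst (λ s → proj₁ (descend N s) ∈ Th X) (sym (prefix-α n)) (walk-holds n)
        where
          walk : ℕ → List Bool
          walk zero    = []
          walk (suc n) = holds (cut (descend N (walk n)) ∈ Th X) ∷ walk n
          α : ℕ → Bool
          α n = holds (cut (descend N (walk n)) ∈ Th X)
          prefix-α : ∀ n → prefix α n ≡ walk n
          prefix-α zero    = refl
          prefix-α (suc n) = cong (α n ∷_) (prefix-α n)
          walk-holds : ∀ n → proj₁ (descend N (walk n)) ∈ Th X
          walk-holds zero    = s₀
          walk-holds (suc n) = conj⁺ X [] (proj₁ D) (literal (cut D) (α n))
                                 (walk-holds n) (literal-holds X (cut D))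
            where
              D : Node
              D = descend N (walk n)

      branch : ∀ N α → ∃[ Z ] Limit Z × Passes N α Z
      branch N α =
        let is n = proj₁ (proj₂ (descend N (prefix α n)))
            Z , lim , eventually = sequence-limit is
              (λ n → proj₁ (proj₂ (proj₂ (descend N (prefix α n)))))
        in Z , lim , λ m → eventually (at N α m) m λ n m≤n →
             at-anti N α (A (is n)) (≤⇒≤′ m≤n) (proj₂ (proj₂ (proj₂ (descend N (prefix α n)))))

      point-of : Node → (ℕ → Bool) → Structure L
      point-of N α = proj₁ (branch N α)

      point-of-limit : ∀ N α → Limit (point-of N α)
      point-of-limit N α = proj₁ (proj₂ (branch N α))

      point-of-passes : ∀ N α → Passes N α (point-of N α)
      point-of-passes N α = proj₂ (proj₂ (branch N α))

      on-branch : ∀ N {α β} Y → Passes N α Y → Y ≡ₑ point-of N β → α ≗ β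
      on-branch N {α} {β} Y p e = passes-unique N Y p
        (λ n → proj₂ e {at N β n} (point-of-passes N β n))

      point-of-injective : ∀ N {α β} → point-of N α ≡ₑ point-of N β → α ≗ β
      point-of-injective N {α} = on-branch N (point-of N α) (point-of-passes N α)

      Spread : Set₁
      Spread = Σ[ x ∈ ((ℕ → Bool) → Structure L) ]
        (∀ α → Limit (x α)) × (∀ {α β} → x α ≡ₑ x β → α ≗ β) ×
        (∀ ψ → Occurs A φ₀ ψ → ∃[ Y ] Limit Y × ψ ∈ Th Y × (∀ α → ¬ Y ≡ₑ x α))

      -- If every nonempty open set contains two theories on a common branch,
      -- one theory chosen on each branch leaves a dense complement.  Otherwise
      -- the branches separate the theories containing some ψ⋆, so that this part
      -- of the space has a countable base.
      Ambiguous : Sentence L → Set₁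
      Ambiguous ψ = ∃[ α ] ∃[ Y ] ∃[ Y′ ]
        (Limit Y × ψ ∈ Th Y × Passes root α Y) ×
        (Limit Y′ × ψ ∈ Th Y′ × Passes root α Y′) × ¬ Y ≡ₑ Y′

      spread-ambiguous : (∀ ψ → Occurs A φ₀ ψ → Ambiguous ψ) → Spread
      spread-ambiguous amb =
        point-of root , point-of-limit root , point-of-injective root , avoiding
        where
          avoiding : ∀ ψ → Occurs A φ₀ ψ →
                     ∃[ Y ] Limit Y × ψ ∈ Th Y × (∀ α → ¬ Y ≡ₑ point-of root α)
          avoiding ψ o with amb ψ o
          ... | α , Y , Y′ , (lim , s , p) , (lim′ , s′ , p′) , Y≢Y′
            -- A chosen theory lies only on its own branch, so if `Y` and `Y′` were both chosen,
            -- both would be the choice for `α` and hence equivalent.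
            with em _ {P = ∃[ β ] Y ≡ₑ point-of root β}
          ...   | no ¬e = Y , lim , s , λ β e → ¬e (β , e)
          ...   | yes (β , e) = Y′ , lim′ , s′ , λ γ e′ →
            Y≢Y′ (≡ₑ-trans {Y = point-of root β} e
                   (subst (λ δ → point-of root δ ≡ₑ Y′)
                     (trans (sym (ext _ _ (on-branch root Y′ p′ e′)))
                       (ext _ _ (on-branch root Y p e)))
                     (≡ₑ-sym {Y = point-of root γ} e′)))

      module Separated (ψ⋆ : Sentence L) (o⋆ : Occurs A φ₀ ψ⋆)
                       (unambiguous : ¬ Ambiguous ψ⋆) where

        separated : ∀ α Y Y′ → Limit Y → ψ⋆ ∈ Th Y → Passes root α Y →
                    Limit Y′ → ψ⋆ ∈ Th Y′ → Passes root α Y′ → Y ≡ₑ Y′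
        separated α Y Y′ l s p l′ s′ p′ =
          stable λ ¬e → unambiguous (α , Y , Y′ , (l , s , p) , (l′ , s′ , p′) , ¬e)

        N⋆ : Node
        N⋆ = ψ⋆ , o⋆

        -- By compactness: the sets at root α n shrink to a single limit.
        basic : ∀ α Y → Limit Y → ψ⋆ ∈ Th Y → Passes root α Y → ∀ ψ → ψ ∈ Th Y →
                ∃[ n ] (∀ i → φ₀ ∈ Th (A i) → ψ⋆ ∈ Th (A i) →
                               at root α n ∈ Th (A i) → ψ ∈ Th (A i))
        basic α Y lim s p ψ t = stable λ ¬∃ →
          let counter : ∀ n → ∃[ i ] φ₀ ∈ Th (A i) × ψ⋆ ∈ Th (A i) ×
                                     at root α n ∈ Th (A i) × ψ ∉ Th (A i)
              counter n = stable λ ¬c → ¬∃ (n , λ i p q r → stable λ ¬t → ¬c (i , p , q , r , ¬t))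
              Z , limZ , eventually = sequence-limit (proj₁ ∘ counter)
                (λ n → proj₁ (proj₂ (counter n)))
              sZ = eventually ψ⋆ 0 (λ n _ → proj₁ (proj₂ (proj₂ (counter n))))
              pZ m = eventually (at root α m) m (λ n m≤n →
                at-anti root α (A (proj₁ (counter n))) (≤⇒≤′ m≤n)
                  (proj₁ (proj₂ (proj₂ (proj₂ (counter n))))))
              ¬tZ = eventually (neg ψ) 0 (λ n _ → proj₂ (proj₂ (proj₂ (proj₂ (counter n)))))
          in ¬tZ (proj₁ (separated α Y Z lim s p limZ sZ pZ) {ψ} t)

        cell : List Bool → Sentence L
        cell s = conj ψ⋆ (proj₁ (descend root s))

        -- The centres of the nonempty cells are countably many and dense in ψ⋆.
        -- The second tree is thinned out by a diagonal sequence β⋆ such that the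
        -- remaining branches avoid all centres.
        choose : ∀ s → Dec (Occurs A φ₀ (cell s)) → Structure L
        choose s (yes o) = point-of (cell s , o) (λ _ → true)
        choose s (no _)  = point-of root (λ _ → true)

        centre : List Bool → Structure L
        centre s = choose s (em _)

        centre-cell : ∀ s → Occurs A φ₀ (cell s) → Limit (centre s) × cell s ∈ Th (centre s)
        centre-cell s o = go (em _)
          where
            go : ∀ d → Limit (choose s d) × cell s ∈ Th (choose s d)
            go (yes o) = point-of-limit (cell s , o) _ , point-of-passes (cell s , o) (λ _ → true) 0
            go (no ¬o) = contradiction o ¬o

        Hit : ℕ → Set
        Hit n = ∃[ s ] ∃[ γ ] encode s ≡ n × centre s ≡ₑ point-of N⋆ γ

        -- `merge` puts bit `n` of `β⋆` at place `suc (double n)`; negating the bit found there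
        -- drives the centre coded by `n` off every remaining branch.
        diagonal : ∀ n → Dec (Hit n) → Bool
        diagonal n (yes (_ , γ , _)) = not (γ (suc (double n)))
        diagonal n (no _)            = true

        β⋆ : ℕ → Bool
        β⋆ n = diagonal n (em _)

        x : (ℕ → Bool) → Structure L
        x α = point-of N⋆ (merge α β⋆)

        centre-avoids : ∀ s α → ¬ centre s ≡ₑ x α
        centre-avoids s α e = go (em _) (merge-odd α β⋆ (encode s))
          where
            go : (d : Dec (Hit (encode s))) →
                 merge α β⋆ (suc (double (encode s))) ≡ diagonal (encode s) d → ⊥
            go (no ¬h) _ = ¬h (s , merge α β⋆ , refl , e)
            go (yes (t , γ , et , e′)) q with encode-injective t s et
            ... | refl = not-¬ refl (trans (point-of-injective N⋆ {γ} {merge α β⋆}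
                (≡ₑ-trans {Y = centre t} (≡ₑ-sym {Y = point-of N⋆ γ} e′) e)
                (suc (double (encode t)))) q)

        x-injective : ∀ {α β} → x α ≡ₑ x β → α ≗ β
        x-injective {α} {β} e n =
          trans (sym (merge-even α β⋆ n))
            (trans (point-of-injective N⋆ e (double n)) (merge-even β β⋆ n))

        avoiding : ∀ ψ → Occurs A φ₀ ψ →
                   ∃[ Y ] Limit Y × ψ ∈ Th Y × (∀ α → ¬ Y ≡ₑ x α)
        avoiding ψ o with em _ {P = Occurs A φ₀ (conj ψ (neg ψ⋆))}
        -- All `x α` satisfy `ψ⋆`, so any limit in `ψ` outside `ψ⋆` will do.
        ... | yes o′ =
          let N = conj ψ (neg ψ⋆) , o′
              Y = point-of N (λ _ → true)
              s , ¬s⋆ = conj⁻ Y [] ψ (neg ψ⋆) (point-of-passes N (λ _ → true) 0)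
          in Y , point-of-limit N _ , s , λ α e →
               ¬s⋆ (proj₂ e {ψ⋆} (point-of-passes N⋆ (merge α β⋆) 0))
        -- Here `ψ` lies inside `ψ⋆`: some cell around a limit in `ψ` is contained in `ψ`, and its
        -- centre is never an `x α`.
        ... | no ¬o′ =
          let i , p , s = o
              s⋆ = stable λ ¬s⋆ → ¬o′ (i , p , conj⁺ (A i) [] ψ (neg ψ⋆) s ¬s⋆)
              N = conj ψ ψ⋆ , i , p , conj⁺ (A i) [] ψ ψ⋆ s s⋆
              Y = point-of N (λ _ → true)
              t , t⋆ = conj⁻ Y [] ψ ψ⋆ (point-of-passes N (λ _ → true) 0)
              α , path = follow root Y id
              n , inside = basic α Y (point-of-limit N _) t⋆ path ψ t
              c = prefix α n
              limC , sC = centre-cell c (point-of-limit N _ (cell c)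
                            (conj⁺ Y [] ψ⋆ (at root α n) t⋆ (path n)))
              C = centre c
          in C , limC ,
             (stable λ ¬t →
                let j , q , u = limC (conj (cell c) (neg ψ)) (conj⁺ C [] (cell c) (neg ψ) sC ¬t)
                    v , w = conj⁻ (A j) [] (cell c) (neg ψ) u
                    v⋆ , vₙ = conj⁻ (A j) [] ψ⋆ (at root α n) v
                in w (inside j q v⋆ vₙ)) ,
             centre-avoids c

        spread-separated : Spread
        spread-separated = x , (λ α → point-of-limit N⋆ _) , x-injective , avoiding

      spread : Spread
      spread with em _ {P = ∃[ ψ ] Occurs A φ₀ ψ × ¬ Ambiguous ψ}
      ... | yes (ψ , o , ¬a) = Separated.spread-separated ψ o ¬a
      ... | no ¬∃ = spread-ambiguous λ ψ o → stable λ ¬a → ¬∃ (ψ , o , ¬a)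

      -- Each forbidden component is escaped by passing to the half of a cut that it misses; what is
      -- left is still inhabited.
      abundant : Abundant A φ₀
      abundant ψ o {n} is =
        let χ , (i , p , s) , below , miss = shrink n is
        in i , (λ k e → miss k (subst (λ j → χ ∈ Th (A j)) (sym e) s)) , p , below (A i) s
        where
          shrink : ∀ n (is : Fin n → I) →
                   ∃[ χ ] Occurs A φ₀ χ × (∀ X → χ ∈ Th X → ψ ∈ Th X) ×
                     (∀ k → χ ∉ Th (A (is k)))
          shrink zero    is = ψ , o , (λ _ → id) , λ ()
          shrink (suc n) is with shrink n (is ∘ suc)
          ... | χ , oχ , below , miss =
            proj₁ (child N b) , proj₂ (child N b) ,
            (λ X s → below X (proj₁ (conj⁻ X [] χ (literal (cut N) b) s))) , λ where
              zero    s → not-¬ refl (literal-unique (A (is zero)) (cut N) _ b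
                            (literal-holds (A (is zero)) (cut N))
                            (proj₂ (conj⁻ (A (is zero)) [] χ (literal (cut N) b) s)))
              (suc k) s → miss k (proj₁ (conj⁻ (A (is (suc k))) [] χ (literal (cut N) b) s))
            where
              N : Node
              N = χ , oχ
              b : Bool
              b = not (holds (cut N ∈ Th (A (is zero))))

    module _ {L : Language} where

      -- Isolated theories

      ⊆Cl-E : (S : Theories L) → S ⊆ Cl-E S
      ⊆Cl-E S {T} T∈ = Closure⊆Cl-E S {T} λ φ φ∈ → T , T∈ , φ∈

      Cl-E-mono : (S S′ : Theories L) → S ⊆ S′ → Cl-E S ⊆ Cl-E S′
      Cl-E-mono S S′ sub {T} T∈ = Closure⊆Cl-E S′ {T} λ φ φ∈ →
        let T′ , T′∈ , φ∈′ = Cl-E⊆Closure S {T} T∈ φ φ∈ in T′ , sub T′∈ , φ∈′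

      Cl-E-closed : (S : Theories L) → EClosed (Cl-E S)
      Cl-E-closed S = (λ {T} → ⊆Cl-E (Cl-E S) {T}) , λ {T} T∈ → Closure⊆Cl-E S {T} λ φ φ∈ →
        let T′ , T′∈ , φ∈′ = Cl-E⊆Closure (Cl-E S) {T} T∈ φ φ∈
        in Cl-E⊆Closure S {T′} T′∈ φ φ∈′

      EClosed-respects : {S : Theories L} → EClosed S → S Respects _≈_
      EClosed-respects {S} (_ , cl) {T} {T′} (p , q) T∈ =
        cl (Closure⊆Cl-E S {T′} λ φ φ∈ → T , T∈ , q φ∈)

      separate : {S : Theories L} → EClosed S → ∀ {T} → T ∉ S →
                 ∃[ φ ] φ ∈ sentences T × (∀ T′ → T′ ∈ S → φ ∉ sentences T′)
      separate {S} (_ , cl) {T} T∉ = stable λ ¬∃ → T∉ (cl (Closure⊆Cl-E S {T} λ φ φ∈ →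
        stable λ ¬T′ → ¬∃ (φ , φ∈ , λ T′ T′∈ φ∈′ → ¬T′ (T′ , T′∈ , φ∈′))))

      conj∈⁺ : ∀ T (φ ψ : Sentence L) → φ ∈ sentences T → ψ ∈ sentences T →
               conj φ ψ ∈ sentences T
      conj∈⁺ T φ ψ p q =
        let B , to , from = model T in from (conj⁺ B [] φ ψ (to p) (to q))

      conj∈⁻ : ∀ T (φ ψ : Sentence L) → conj φ ψ ∈ sentences T →
               φ ∈ sentences T × ψ ∈ sentences T
      conj∈⁻ T φ ψ r =
        let B , to , from = model T
            p , q = conj⁻ B [] φ ψ (to r)
        in from p , from q

      ≈-from-⊆ : (S T : Theory L) → sentences S ⊆ sentences T → S ≈ T
      ≈-from-⊆ S T sub = sub , λ {φ} φ∈ →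
        [ id , (λ ¬φ∈ → let B , to , _ = model T in contradiction (to φ∈) (to (sub ¬φ∈))) ]′
          (complete S φ)

    -- Isolated theories as the least generating set

    module _ {L : Language} {I : Set} (i₀ : I) (Ts : I → Theory L) (T : Theory (L +E))
             (A : I → Structure L) (A-theory : ∀ i → A i HasTheory Ts i)
             (T-theory : Comb i₀ A HasTheory T)
             (𝒯 : Theories L) (𝒯-closed : EClosed 𝒯) where

      private
        X : Theories L
        X = Cl-E (𝒯 ∪ Range Ts)

      IsolatedBy : Sentence L → Theories L
      IsolatedBy φ T′ = φ ∈ sentences T′ × (∀ T″ → T″ ∈ X → φ ∈ sentences T″ → T″ ≈ T′)

      -- Isolation is asked within all of `X`; since `𝒯` is closed, for a theory outside `𝒯` this
      -- amounts to isolation within `X ∖ 𝒯`.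
      Isolated : Theories L
      Isolated T′ = T′ ∈ X × T′ ∉ 𝒯 × (∃[ φ ] T′ ∈ IsolatedBy φ)

      isolated-respects : Isolated Respects _≈_
      isolated-respects {T₁} {T₂} (p , q) (T∈ , T∉ , φ , φ∈ , unique) =
        EClosed-respects (Cl-E-closed (𝒯 ∪ Range Ts)) {T₁} {T₂} (p , q) T∈ ,
        (λ T′∈ → T∉ (EClosed-respects 𝒯-closed {T₂} {T₁} (q , p) T′∈)) ,
        φ , p φ∈ , λ T″ T″∈ φ∈″ →
          let r , s = unique T″ T″∈ φ∈″ in (λ ψ∈ → p (r ψ∈)) , (λ ψ∈ → s (q ψ∈))

      -- The isolating sentence admits only one approximation from `S`. Minimality and leastness
      -- both rest on this.
      isolated-∈ : (S : Theories L) → S Respects _≈_ → S ⊆ X →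
                   ∀ {T′} → T′ ∈ Isolated → T′ ∈ Cl-E S → T′ ∈ S
      isolated-∈ S resp sub {T′} (_ , _ , φ , φ∈ , unique) T∈ =
        let T″ , T″∈ , φ∈″ = Cl-E⊆Closure S {T′} T∈ φ φ∈ in resp (unique T″ (sub T″∈) φ∈″) T″∈

      module Perfect (φ₀ : Sentence L) (avoids : ∀ T′ → T′ ∈ 𝒯 → φ₀ ∉ sentences T′)
                     (T₀ : Theory L) (T₀∈ : T₀ ∈ X) (φ₀∈ : φ₀ ∈ sentences T₀)
                     (none : ∀ T′ → T′ ∈ Isolated → φ₀ ∉ sentences T′) where

        -- `φ₀` excludes approximations from `𝒯`, so they come from the given components.
        occurs-in : ∀ T′ → T′ ∈ X → φ₀ ∈ sentences T′ → ∀ ψ → ψ ∈ sentences T′ →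
                    Occurs A φ₀ ψ
        occurs-in T′ T′∈ p ψ q
          with Cl-E⊆Closure (𝒯 ∪ Range Ts) {T′} T′∈ (conj φ₀ ψ) (conj∈⁺ T′ φ₀ ψ p q)
        ... | T₁ , inj₁ T₁∈ , r = contradiction (proj₁ (conj∈⁻ T₁ φ₀ ψ r)) (avoids T₁ T₁∈)
        ... | T₁ , inj₂ (i , to , _) , r =
          let p₁ , q₁ = conj∈⁻ T₁ φ₀ ψ r
          in i , proj₁ (A-theory i) (to p₁) , proj₁ (A-theory i) (to q₁)

        member : ∀ i → Ts i ∈ X
        member i = ⊆Cl-E (𝒯 ∪ Range Ts) {Ts i} (inj₂ (i , id , id))

        -- If nothing split `ψ`, every member of `X` containing `conj φ₀ ψ` would equal `Ts i`,
        -- which would then be isolated, against `none`.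
        perfect : ∀ ψ → Occurs A φ₀ ψ →
                  ∃[ χ ] Occurs A φ₀ (conj ψ χ) × Occurs A φ₀ (conj ψ (neg χ))
        perfect ψ (i , p , s) = stable λ ¬split →
          let φ₀∈′ = proj₂ (A-theory i) p
              ψ∈′ = proj₂ (A-theory i) s
          in none (Ts i)
               (member i , (λ Ts∈ → avoids (Ts i) Ts∈ φ₀∈′) , conj φ₀ ψ ,
                conj∈⁺ (Ts i) φ₀ ψ φ₀∈′ ψ∈′ , λ T″ T″∈ r →
                  let p″ , s″ = conj∈⁻ T″ φ₀ ψ r
                  in ≈-from-⊆ T″ (Ts i) λ {χ} χ∈ → proj₂ (A-theory i) (stable λ ¬t →
                       ¬split (χ , occurs-in T″ T″∈ p″ (conj ψ χ) (conj∈⁺ T″ ψ χ s″ χ∈) ,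
                               i , p , conj⁺ (A i) [] ψ (neg χ) s ¬t)))
               φ₀∈′

        inhabited : ∃[ i ] φ₀ ∈ Th (A i)
        inhabited = let i , p , _ = occurs-in T₀ T₀∈ φ₀∈ φ₀ φ₀∈ in i , p

        open Scattered A φ₀ inhabited perfect

        module _ {J : Set} (j₀ : J) (B : J → Structure L) (limits : ∀ j → Limit (B j))
                 (dense : ∀ ψ → Occurs A φ₀ ψ → ∃[ j ] ψ ∈ Th (B j)) where

          replacement : Structure (L +E)
          replacement = Comb (inj₂ (j₀ , 0)) (replace A B φ₀)

          replacement-⊨ : replacement ⊨ T
          replacement-⊨ {φ} φ∈ =
            proj₁ (comb-replace A B φ₀ (λ j → limit-φ₀ {B j} (limits j)) limits dense abundant
                     i₀ j₀)
              {φ} (proj₁ T-theory φ∈)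

          replacement-theories : ∀ Y → φ₀ ∈ Th Y → (∀ j → ¬ B j ≡ₑ Y) →
                                 ¬ IsClassTheory replacement (theoryOf Y)
          replacement-theories Y p differ c
            with isClassTheory⁻ (inj₂ (j₀ , 0)) (replace A B φ₀) (theoryOf Y) c
          ... | inj₁ (i , [ ¬p ]) , to , _ = ⊥-elim-irr (¬p (to {φ₀} p))
          ... | inj₂ (j , _) , to , from = differ j ((λ {φ} → from {φ}) , (λ {φ} → to {φ}))

        continuum : ∀ {κ} → IsESp 𝒯 T κ → 2^ω ≲ κ
        continuum esp = injection embed (IsESp.upper esp M M⊨T)
          where
            x = proj₁ spread
            x-limit = proj₁ (proj₂ spread)
            x-injective = proj₁ (proj₂ (proj₂ spread))
            avoiding = proj₂ (proj₂ (proj₂ spread))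

            ψ₀ : ∃ (Occurs A φ₀)
            ψ₀ = φ₀ , occurs-in T₀ T₀∈ φ₀∈ φ₀ φ₀∈

            omitting : ∃ (Occurs A φ₀) → Structure L
            omitting (ψ , o) = proj₁ (avoiding ψ o)

            omitting-limit : ∀ j → Limit (omitting j)
            omitting-limit (ψ , o) = proj₁ (proj₂ (avoiding ψ o))

            omitting-dense : ∀ ψ → Occurs A φ₀ ψ → ∃[ j ] ψ ∈ Th (omitting j)
            omitting-dense ψ o = (ψ , o) , proj₁ (proj₂ (proj₂ (avoiding ψ o)))

            M : Structure (L +E)
            M = replacement ψ₀ omitting omitting-limit omitting-dense

            M⊨T : M ⊨ T
            M⊨T = replacement-⊨ ψ₀ omitting omitting-limit omitting-dense

            -- Keeping all old components that satisfy `φ₀` makes density immediate; `x α` is merely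
            -- added to them.
            realising : (ℕ → Bool) → ⊤ ⊎ (Σ[ i ∈ I ] φ₀ ∈ Th (A i)) → Structure L
            realising α (inj₁ _)       = x α
            realising α (inj₂ (i , _)) = A i

            realising-limit : ∀ α j → Limit (realising α j)
            realising-limit α (inj₁ _)           = x-limit α
            realising-limit α (inj₂ (i , p)) ψ s = i , p , s

            realising-dense : ∀ α ψ → Occurs A φ₀ ψ → ∃[ j ] ψ ∈ Th (realising α j)
            realising-dense α ψ (i , p , s) = inj₂ (i , p) , s

            omitted : ∀ α → theoryOf (x α) ∈ ESpTheories 𝒯 T M
            omitted α =
              (replacement (inj₁ tt) (realising α) (realising-limit α) (realising-dense α) ,
               (λ {φ} → replacement-⊨ (inj₁ tt) (realising α) (realising-limit α)
                          (realising-dense α) {φ}) ,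
               isClassTheory⁺ (inj₂ (inj₁ tt , 0)) (replace A (realising α) φ₀)
                 (inj₂ (inj₁ tt , 0)) (theoryOf (x α)) (id , id)) ,
              replacement-theories ψ₀ omitting omitting-limit omitting-dense (x α)
                (limit-φ₀ {x α} (x-limit α))
                (λ (ψ , o) → proj₂ (proj₂ (proj₂ (avoiding ψ o))) α) ,
              λ x∈ → avoids (theoryOf (x α)) x∈ (limit-φ₀ {x α} (x-limit α))

            embed : 2^ω ≲ ∥ ESpTheories 𝒯 T M ∥
            embed = record
              { to        = λ α → theoryOf (x α) , omitted α
              ; cong      = λ {α} {β} e → subst (λ γ → x α ≡ₑ x γ) (ext _ _ e) (id , id)
              ; injective = x-injective
              }

      module _ {κ : Cardinal} (esp : IsESp 𝒯 T κ) (small : κ ⋦ 2^ω) where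

        isolated-dense : X ∖ 𝒯 ⊆ Cl-E Isolated
        isolated-dense {T′} (T∈ , T∉) = Closure⊆Cl-E Isolated {T′} λ φ φ∈ → stable λ ¬∃ →
          let ψ , ψ∈ , avoids = separate 𝒯-closed T∉
          -- `φ` is a neighbourhood of `T′` without isolated theories and `ψ` one that misses `𝒯`;
          -- their conjunction cuts out the perfect part.
          in proj₂ small (Perfect.continuum (conj φ ψ)
               (λ S S∈ r → avoids S S∈ (proj₂ (conj∈⁻ S φ ψ r)))
               T′ T∈ (conj∈⁺ T′ φ ψ φ∈ ψ∈)
               (λ S S-isolated r → ¬∃ (S , S-isolated , proj₁ (conj∈⁻ S φ ψ r))) esp)

        isolated-least : IsLeastGenerating 𝒯 X Isolated
        isolated-least = record
          { minimalGenerating = record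
            { generating = record
              { closed    = Cl-E-closed (𝒯 ∪ Range Ts)
              ; respects  = isolated-respects
              ; subset    = proj₁
              ; generates = (λ {T′} (T∈ , T∉) → isolated-dense {T′} (T∈ , T∉) , T∉) ,
                            λ {T′} (T∈ , T∉) → proj₂ (Cl-E-closed (𝒯 ∪ Range Ts)) {T′}
                              (Cl-E-mono Isolated X proj₁ {T′} T∈) , T∉
              }
            ; minimal = λ (S , resp , (sub , proper) , gen , _) → proper λ {T′} (iso , T∉) →
                let S′ = (Isolated ∩ 𝒯) ∪ S
                    T∈ , _ = gen {T′} (proj₁ iso , T∉)
                in isolated-∈ S resp (λ S∈ → proj₁ (proj₁ (sub S∈))) {T′} iso
                     -- No isolated theory lies in `𝒯`, so `S` has to generate on its own.
                     (Cl-E-mono S′ S (λ { (inj₁ ((_ , T∉ , _) , T∈)) → contradiction T∈ T∉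
                                        ; (inj₂ T∈) → T∈ }) {T′} T∈)
            }
          ; least = λ S gen {T′} (iso , T∉) →
              isolated-∈ S (IsGenerating.respects gen) (IsGenerating.subset gen) {T′} iso
                (proj₁ (proj₁ (IsGenerating.generates gen) {T′} (proj₁ iso , T∉))) , T∉
          }

theorem4p6 : (∀ ℓ → ExcludedMiddle ℓ) → (∀ a b → Extensionality a b) →
    (L : Language) (I : Set) (i₀ : I)
    (Ts : I → Theory L) (T : Theory (L +E)) → IsECombination i₀ T Ts →
    (𝒯 : Theories L) → EClosed 𝒯 →
    (κ : Cardinal) → IsESp 𝒯 T κ → κ ⋦ 2^ω →
    Σ[ 𝒯₀′ ∈ Theories L ] IsLeastGenerating 𝒯 (Cl-E (𝒯 ∪ Range Ts)) 𝒯₀′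
theorem4p6 em ext L I i₀ Ts T (A , A-theory , T-theory) 𝒯 𝒯-closed κ esp small =
  _ , isolated-least em ext i₀ Ts T A A-theory T-theory 𝒯 𝒯-closed esp small
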